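{- For every finite connected weighted graph $G=(V,E,w)$ with $|V|=n\ge2$ and $w:E\to\mathbb{R}_{>0}$, $$\frac{\operatorname{OPT}_D(G,w)}{\operatorname{OPT}_{\mathrm{free}}(G,w)}\le\frac{2(n+1)}{3}.$$ The factor is best possible and is attained by the unweighted complete graph $K_n$ (all edge weights equal to $1$).
   Context: $d_G$ is the shortest-path metric of the support graph $(V,E)$ with every edge of length $1$; the weights are not edge lengths. An ultrametric on $V$ is a metric $u$ with $u(x,y)\le\max\{u(x,z),u(z,y)\}$ for all $x,y,z$. $\operatorname{OPT}_{\mathrm{free}}(G,w)$ is the minimum of $\sum_{xy\in E}w_{xy}u(x,y)$ over all ultrametrics $u$ on $V$ with $u(x,y)\ge d_G(x,y)$ for all $x,y\in V$ (the minimum is attained). A rooted binary hierarchy $T$ on $V$ is a rooted tree whose leaves are the vertices of $V$ and whose internal nodes have exactly two children; each node is identified with the set of leaves below it (a cluster), and $C_T(x,y)$ is the cluster of the lowest common ancestor of $x,y$. $\operatorname{OPT}_D(G,w)$ is the minimum of the standard Dasgupta cost $\sum_{xy\in E}w_{xy}|C_T(x,y)|$ over all rooted binary hierarchies $T$ on $V$. -}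

module Defs where

open import Algebra.Bundles.Raw using (RawMonoid)
open import Data.Bool.Base using (Bool; true; false; not; T)
open import Data.Bool.Properties using (T?)
open import Data.Empty using (⊥-elim)
open import Data.Fin.Base as Fin using (Fin)
import Data.Fin.Properties as Fin
open import Data.Fin.Subset using (Subset; ⊤; ⁅_⁆; _∩_; _∪_; _∈_; Empty; ∣_∣)
open import Data.Fin.Subset.Properties using (_∈?_)
open import Data.Integer.Base using (+_)
open import Data.Nat.Base as ℕ using (ℕ; zero; suc)
import Data.Nat.Properties as ℕ
open import Data.Product.Base using (Σ; ∃; _×_; _,_; proj₁; proj₂)
open import Data.Rational.Base as ℚ using (ℚ; 0ℚ; 1ℚ; ½; 1/_)
import Data.Rational.Properties as ℚ
open import Data.Rational.Solver using (module +-*-Solver)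
open import Data.Sum.Base using (inj₁; inj₂)
open import Function.Metric.Structures using (IsGeneralMetric)
open import Level using (0ℓ)
open import Relation.Binary.PropositionalEquality
  using (_≡_; refl; sym; trans; cong; cong₂; subst)
open import Relation.Nullary.Decidable using (Dec; yes; no; _×-dec_; ⌊_⌋)
open import Relation.Nullary.Negation using (¬_)

private
  variable
    n : ℕ

private abstract
  halves : ∀ ε → ½ ℚ.* ε ℚ.+ ½ ℚ.* ε ≡ ε
  halves = solve 1 (λ e → con ½ :* e :+ con ½ :* e := e) refl
    where
    open +-*-Solver

  *-difference : ∀ a b c d →
    a ℚ.* b ℚ.- c ℚ.* d ≡ a ℚ.* (b ℚ.- d) ℚ.+ d ℚ.* (a ℚ.- c)
  *-difference =
    solve 4 (λ a b c d → a :* b :- c :* d := a :* (b :- d) :+ d :* (a :- c)) refl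
    where
    open +-*-Solver

  expand : ∀ a b c d →
    (c ℚ.- d) ℚ.* (a ℚ.* b) ≡ a ℚ.* c ℚ.* b ℚ.- b ℚ.* d ℚ.* a
  expand =
    solve 4 (λ a b c d → (c :- d) :* (a :* b) := a :* c :* b :- b :* d :* a) refl
    where
    open +-*-Solver

  0<p*q : ∀ {p q} → 0ℚ ℚ.< p → 0ℚ ℚ.< q → 0ℚ ℚ.< p ℚ.* q
  0<p*q {p} {q} 0<p 0<q =
    ℚ.positive⁻¹ (p ℚ.* q)
      {{ℚ.pos*pos⇒pos p {{ℚ.positive 0<p}} q {{ℚ.positive 0<q}}}}

  0<½ε : ∀ {ε} → 0ℚ ℚ.< ε → 0ℚ ℚ.< ½ ℚ.* ε
  0<½ε = 0<p*q (ℚ.positive⁻¹ ½)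

  p≤∣p∣ : ∀ p → p ℚ.≤ ℚ.∣ p ∣
  p≤∣p∣ p with ℚ.≤-total 0ℚ p
  ... | inj₁ 0≤p = ℚ.≤-reflexive (sym (ℚ.0≤p⇒∣p∣≡p 0≤p))
  ... | inj₂ p≤0 = ℚ.≤-trans p≤0 (ℚ.0≤∣p∣ p)

  ∣p-q∣≡∣q-p∣ : ∀ p q → ℚ.∣ p ℚ.- q ∣ ≡ ℚ.∣ q ℚ.- p ∣
  ∣p-q∣≡∣q-p∣ p q =
    trans (cong ℚ.∣_∣ (solve 2 (λ a b → a :- b := :- (b :- a)) refl p q))
          (ℚ.∣-p∣≡∣p∣ (q ℚ.- p))
    where
    open +-*-Solver

  ∣p-q∣<ε⇒p<q+ε : ∀ p q {ε} → ℚ.∣ p ℚ.- q ∣ ℚ.< ε → p ℚ.< q ℚ.+ ε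
  ∣p-q∣<ε⇒p<q+ε p q {ε} h = begin-strict
    p                 ≡⟨ solve 2 (λ a b → a := b :+ (a :- b)) refl p q ⟩
    q ℚ.+ (p ℚ.- q)   <⟨ ℚ.+-monoʳ-< q (ℚ.≤-<-trans (p≤∣p∣ (p ℚ.- q)) h) ⟩
    q ℚ.+ ε           ∎
    where
    open ℚ.≤-Reasoning
    open +-*-Solver

  p<q+ε⇒p-q<ε : ∀ p q {ε} → p ℚ.< q ℚ.+ ε → p ℚ.- q ℚ.< ε
  p<q+ε⇒p-q<ε p q {ε} h = begin-strict
    p ℚ.- q           <⟨ ℚ.+-monoˡ-< (ℚ.- q) h ⟩
    q ℚ.+ ε ℚ.- q     ≡⟨ solve 2 (λ b e → b :+ e :- b := e) refl q ε ⟩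
    ε                 ∎
    where
    open ℚ.≤-Reasoning
    open +-*-Solver

  ∣p-q∣<ε : ∀ p q {ε} → p ℚ.< q ℚ.+ ε → q ℚ.< p ℚ.+ ε → ℚ.∣ p ℚ.- q ∣ ℚ.< ε
  ∣p-q∣<ε p q h k with ℚ.∣p∣≡p∨∣p∣≡-p (p ℚ.- q)
  ... | inj₁ eq = subst (ℚ._< _) (sym eq) (p<q+ε⇒p-q<ε p q h)
  ... | inj₂ eq = subst (ℚ._< _)
    (trans (solve 2 (λ a b → b :- a := :- (a :- b)) refl p q) (sym eq))
    (p<q+ε⇒p-q<ε q p k)
    where
    open +-*-Solver

  ⊔-lub-< : ∀ p q {r} → p ℚ.< r → q ℚ.< r → p ℚ.⊔ q ℚ.< r
  ⊔-lub-< p q p<r q<r with ℚ.⊔-sel p q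
  ... | inj₁ eq = subst (ℚ._< _) (sym eq) p<r
  ... | inj₂ eq = subst (ℚ._< _) (sym eq) q<r

IsCauchy : (ℕ → ℚ) → Set
IsCauchy x = ∀ ε → 0ℚ ℚ.< ε →
  ∃ λ N → ∀ i j → N ℕ.≤ i → N ℕ.≤ j → ℚ.∣ x i ℚ.- x j ∣ ℚ.< ε

-- Equality of reals is the equivalence _≃_ below, not _≡_.
record ℝ : Set where
  constructor mkℝ
  field
    seq    : ℕ → ℚ
    cauchy : IsCauchy seq

open ℝ public

infix  4 _≃_ _<_ _≤_
infixl 6 _+_ _⊔_
infixl 7 _*_

_≃_ : ℝ → ℝ → Set
x ≃ y = ∀ ε → 0ℚ ℚ.< ε →
  ∃ λ N → ∀ i → N ℕ.≤ i → ℚ.∣ seq x i ℚ.- seq y i ∣ ℚ.< ε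

-- Strictness needs a uniform gap ε between the sequences; termwise < would
-- relate 0 to a null sequence.
_<_ : ℝ → ℝ → Set
x < y = ∃ λ ε → 0ℚ ℚ.< ε ×
  ∃ λ N → ∀ i → N ℕ.≤ i → seq x i ℚ.+ ε ℚ.≤ seq y i

_≤_ : ℝ → ℝ → Set
x ≤ y = ¬ (y < x)

fromℚ : ℚ → ℝ
fromℚ q = mkℝ (λ _ → q) λ ε 0<ε →
  0 , λ _ _ _ _ → subst (ℚ._< ε) (sym (cong ℚ.∣_∣ (ℚ.+-inverseʳ q))) 0<ε

0ℝ 1ℝ : ℝ
0ℝ = fromℚ 0ℚ
1ℝ = fromℚ 1ℚ

private abstract
  +-cauchy : ∀ x y → IsCauchy x → IsCauchy y → IsCauchy (λ i → x i ℚ.+ y i)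
  +-cauchy x y cx cy ε 0<ε
    with cx (½ ℚ.* ε) (0<½ε 0<ε) | cy (½ ℚ.* ε) (0<½ε 0<ε)
  ... | M , hx | N , hy = M ℕ.⊔ N , λ i j ≤i ≤j → begin-strict
    ℚ.∣ (x i ℚ.+ y i) ℚ.- (x j ℚ.+ y j) ∣
      ≡⟨ cong ℚ.∣_∣ (solve 4 (λ a b c d → a :+ b :- (c :+ d) := (a :- c) :+ (b :- d))
                      refl (x i) (y i) (x j) (y j)) ⟩
    ℚ.∣ (x i ℚ.- x j) ℚ.+ (y i ℚ.- y j) ∣
      ≤⟨ ℚ.∣p+q∣≤∣p∣+∣q∣ (x i ℚ.- x j) (y i ℚ.- y j) ⟩
    ℚ.∣ x i ℚ.- x j ∣ ℚ.+ ℚ.∣ y i ℚ.- y j ∣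
      <⟨ ℚ.+-mono-< (hx i j (ℕ.m⊔n≤o⇒m≤o M N ≤i) (ℕ.m⊔n≤o⇒m≤o M N ≤j))
                    (hy i j (ℕ.m⊔n≤o⇒n≤o M N ≤i) (ℕ.m⊔n≤o⇒n≤o M N ≤j)) ⟩
    ½ ℚ.* ε ℚ.+ ½ ℚ.* ε
      ≡⟨ halves ε ⟩
    ε ∎
    where
    open ℚ.≤-Reasoning
    open +-*-Solver

  ⊔-cauchy : ∀ x y → IsCauchy x → IsCauchy y → IsCauchy (λ i → x i ℚ.⊔ y i)
  ⊔-cauchy x y cx cy ε 0<ε with cx ε 0<ε | cy ε 0<ε
  ... | M , hx | N , hy = M ℕ.⊔ N , λ i j ≤i ≤j →
    ∣p-q∣<ε (x i ℚ.⊔ y i) (x j ℚ.⊔ y j) (side i j ≤i ≤j) (side j i ≤j ≤i)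
    where
    side : ∀ i j → M ℕ.⊔ N ℕ.≤ i → M ℕ.⊔ N ℕ.≤ j →
           x i ℚ.⊔ y i ℚ.< x j ℚ.⊔ y j ℚ.+ ε
    side i j ≤i ≤j = ⊔-lub-< (x i) (y i)
      (ℚ.<-≤-trans
        (∣p-q∣<ε⇒p<q+ε (x i) (x j)
          (hx i j (ℕ.m⊔n≤o⇒m≤o M N ≤i) (ℕ.m⊔n≤o⇒m≤o M N ≤j)))
        (ℚ.+-monoˡ-≤ ε (ℚ.p≤p⊔q (x j) (y j))))
      (ℚ.<-≤-trans
        (∣p-q∣<ε⇒p<q+ε (y i) (y j)
          (hy i j (ℕ.m⊔n≤o⇒n≤o M N ≤i) (ℕ.m⊔n≤o⇒n≤o M N ≤j)))
        (ℚ.+-monoˡ-≤ ε (ℚ.p≤q⊔p (x j) (y j))))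

  eventuallyBounded : ∀ x → IsCauchy x →
    ∃ λ B → 0ℚ ℚ.< B × ∃ λ N → ∀ i → N ℕ.≤ i → ℚ.∣ x i ∣ ℚ.≤ B
  eventuallyBounded x cx with cx 1ℚ (ℚ.positive⁻¹ 1ℚ)
  ... | N , h = ℚ.∣ x N ∣ ℚ.+ 1ℚ
              , ℚ.+-mono-≤-< (ℚ.0≤∣p∣ (x N)) (ℚ.positive⁻¹ 1ℚ)
              , N , λ i N≤i → begin
    ℚ.∣ x i ∣
      ≡⟨ cong ℚ.∣_∣ (solve 2 (λ a b → a := b :+ (a :- b)) refl (x i) (x N)) ⟩
    ℚ.∣ x N ℚ.+ (x i ℚ.- x N) ∣
      ≤⟨ ℚ.∣p+q∣≤∣p∣+∣q∣ (x N) (x i ℚ.- x N) ⟩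
    ℚ.∣ x N ∣ ℚ.+ ℚ.∣ x i ℚ.- x N ∣
      ≤⟨ ℚ.+-monoʳ-≤ ℚ.∣ x N ∣ (ℚ.<⇒≤ (h i N N≤i ℕ.≤-refl)) ⟩
    ℚ.∣ x N ∣ ℚ.+ 1ℚ ∎
    where
    open ℚ.≤-Reasoning
    open +-*-Solver

  scaled : ∀ a d B {δ η} → 0ℚ ℚ.< B → ℚ.∣ a ∣ ℚ.≤ B →
           ℚ.∣ d ∣ ℚ.< δ → B ℚ.* δ ≡ η → ℚ.∣ a ℚ.* d ∣ ℚ.< η
  scaled a d B {δ} {η} 0<B a≤B d<δ Bδ≡η = begin-strict
    ℚ.∣ a ℚ.* d ∣            ≡⟨ ℚ.∣p*q∣≡∣p∣*∣q∣ a d ⟩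
    ℚ.∣ a ∣ ℚ.* ℚ.∣ d ∣      ≤⟨ ℚ.*-monoʳ-≤-nonNeg ℚ.∣ d ∣ {{ℚ.∣-∣-nonNeg d}} a≤B ⟩
    B ℚ.* ℚ.∣ d ∣            <⟨ ℚ.*-monoʳ-<-pos B {{ℚ.positive 0<B}} d<δ ⟩
    B ℚ.* δ                  ≡⟨ Bδ≡η ⟩
    η                        ∎
    where
    open ℚ.≤-Reasoning

  *-close : ∀ a b c d A B {δ δ′ η} → 0ℚ ℚ.< A → 0ℚ ℚ.< B →
            ℚ.∣ a ∣ ℚ.≤ A → ℚ.∣ d ∣ ℚ.≤ B →
            ℚ.∣ b ℚ.- d ∣ ℚ.< δ → ℚ.∣ a ℚ.- c ∣ ℚ.< δ′ →
            A ℚ.* δ ≡ η → B ℚ.* δ′ ≡ η →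
            ℚ.∣ a ℚ.* b ℚ.- c ℚ.* d ∣ ℚ.< η ℚ.+ η
  *-close a b c d A B {δ} {δ′} {η} 0<A 0<B a≤A d≤B b-d a-c Aδ Bδ′ = begin-strict
    ℚ.∣ a ℚ.* b ℚ.- c ℚ.* d ∣
      ≡⟨ cong ℚ.∣_∣ (*-difference a b c d) ⟩
    ℚ.∣ a ℚ.* (b ℚ.- d) ℚ.+ d ℚ.* (a ℚ.- c) ∣
      ≤⟨ ℚ.∣p+q∣≤∣p∣+∣q∣ (a ℚ.* (b ℚ.- d)) (d ℚ.* (a ℚ.- c)) ⟩
    ℚ.∣ a ℚ.* (b ℚ.- d) ∣ ℚ.+ ℚ.∣ d ℚ.* (a ℚ.- c) ∣
      <⟨ ℚ.+-mono-< (scaled a (b ℚ.- d) A 0<A a≤A b-d Aδ)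
                    (scaled d (a ℚ.- c) B 0<B d≤B a-c Bδ′) ⟩
    η ℚ.+ η ∎
    where
    open ℚ.≤-Reasoning

  shrink : ∀ b η → 0ℚ ℚ.< b → 0ℚ ℚ.< η → ∃ λ δ → 0ℚ ℚ.< δ × b ℚ.* δ ≡ η
  shrink b η 0<b 0<η =
      b⁻¹ ℚ.* η
    , 0<p*q (ℚ.positive⁻¹ b⁻¹ {{ℚ.1/pos⇒pos b {{ℚ.positive 0<b}}}}) 0<η
    , trans (sym (ℚ.*-assoc b b⁻¹ η))
            (trans (cong (ℚ._* η) (ℚ.*-inverseʳ b {{b≢0}})) (ℚ.*-identityˡ η))
    where
    b≢0 : ℚ.NonZero b
    b≢0 = ℚ.pos⇒nonZero b {{ℚ.positive 0<b}}
    b⁻¹ : ℚ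
    b⁻¹ = (1/ b) {{b≢0}}

private abstract
  *-cauchy : ∀ x y → IsCauchy x → IsCauchy y → IsCauchy (λ i → x i ℚ.* y i)
  *-cauchy x y cx cy ε 0<ε = from-bounds (eventuallyBounded x cx) (eventuallyBounded y cy)
    where
    EventualBound : (ℕ → ℚ) → ℚ → Set
    EventualBound x B = ∃ λ N → ∀ i → N ℕ.≤ i → ℚ.∣ x i ∣ ℚ.≤ B

    Close : (ℕ → ℚ) → ℚ → Set
    Close x δ = ∃ λ N → ∀ i j → N ℕ.≤ i → N ℕ.≤ j → ℚ.∣ x i ℚ.- x j ∣ ℚ.< δ

    from-close : ∀ {A B δ δ′} → 0ℚ ℚ.< A → 0ℚ ℚ.< B →
      EventualBound x A → EventualBound y B → Close y δ → Close x δ′ →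
      A ℚ.* δ ≡ ½ ℚ.* ε → B ℚ.* δ′ ≡ ½ ℚ.* ε → Close (λ i → x i ℚ.* y i) ε
    from-close {A} {B} 0<A 0<B (K , x≤A) (L , y≤B) (N , hy) (M , hx) Aδ Bδ′ =
      (K ℕ.⊔ L) ℕ.⊔ (M ℕ.⊔ N) , λ i j ≤i ≤j →
      subst (ℚ.∣ x i ℚ.* y i ℚ.- x j ℚ.* y j ∣ ℚ.<_) (halves ε)
        (*-close (x i) (y i) (x j) (y j) A B 0<A 0<B
          (x≤A i (ℕ.m⊔n≤o⇒m≤o K L (KL≤ ≤i))) (y≤B j (ℕ.m⊔n≤o⇒n≤o K L (KL≤ ≤j)))
          (hy i j (ℕ.m⊔n≤o⇒n≤o M N (MN≤ ≤i)) (ℕ.m⊔n≤o⇒n≤o M N (MN≤ ≤j)))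
          (hx i j (ℕ.m⊔n≤o⇒m≤o M N (MN≤ ≤i)) (ℕ.m⊔n≤o⇒m≤o M N (MN≤ ≤j)))
          Aδ Bδ′)
      where
      KL≤ : ∀ {i} → (K ℕ.⊔ L) ℕ.⊔ (M ℕ.⊔ N) ℕ.≤ i → K ℕ.⊔ L ℕ.≤ i
      KL≤ = ℕ.m⊔n≤o⇒m≤o (K ℕ.⊔ L) (M ℕ.⊔ N)
      MN≤ : ∀ {i} → (K ℕ.⊔ L) ℕ.⊔ (M ℕ.⊔ N) ℕ.≤ i → M ℕ.⊔ N ℕ.≤ i
      MN≤ = ℕ.m⊔n≤o⇒n≤o (K ℕ.⊔ L) (M ℕ.⊔ N)

    from-moduli : ∀ {A B} → 0ℚ ℚ.< A → 0ℚ ℚ.< B →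
      EventualBound x A → EventualBound y B →
      (∃ λ δ → 0ℚ ℚ.< δ × A ℚ.* δ ≡ ½ ℚ.* ε) →
      (∃ λ δ → 0ℚ ℚ.< δ × B ℚ.* δ ≡ ½ ℚ.* ε) → Close (λ i → x i ℚ.* y i) ε
    from-moduli 0<A 0<B bx by (δ , 0<δ , Aδ) (δ′ , 0<δ′ , Bδ′) =
      from-close 0<A 0<B bx by (cy δ 0<δ) (cx δ′ 0<δ′) Aδ Bδ′

    from-bounds : (∃ λ A → 0ℚ ℚ.< A × EventualBound x A) →
                  (∃ λ B → 0ℚ ℚ.< B × EventualBound y B) →
                  Close (λ i → x i ℚ.* y i) ε
    from-bounds (A , 0<A , bx) (B , 0<B , by) =
      from-moduli 0<A 0<B bx by
        (shrink A (½ ℚ.* ε) 0<A (0<½ε 0<ε)) (shrink B (½ ℚ.* ε) 0<B (0<½ε 0<ε))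

_+_ : ℝ → ℝ → ℝ
x + y = mkℝ (λ i → seq x i ℚ.+ seq y i) (+-cauchy (seq x) (seq y) (cauchy x) (cauchy y))

_*_ : ℝ → ℝ → ℝ
x * y = mkℝ (λ i → seq x i ℚ.* seq y i) (*-cauchy (seq x) (seq y) (cauchy x) (cauchy y))

_⊔_ : ℝ → ℝ → ℝ
x ⊔ y = mkℝ (λ i → seq x i ℚ.⊔ seq y i) (⊔-cauchy (seq x) (seq y) (cauchy x) (cauchy y))

+-0-rawMonoid : RawMonoid 0ℓ 0ℓ
+-0-rawMonoid = record { Carrier = ℝ ; _≈_ = _≃_ ; _∙_ = _+_ ; ε = 0ℝ }

open import Algebra.Definitions.RawMonoid +-0-rawMonoid using (sum) renaming (_×_ to _·_)

fromℕ : ℕ → ℝ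
fromℕ k = k · 1ℝ

-- Finitely many terms of a sequence representing a positive real may vanish;
-- they are sent to 0.
recip : ℚ → ℚ
recip q with q ℚ.≟ 0ℚ
... | yes _  = 0ℚ
... | no q≢0 = (1/ q) {{ℚ.≢-nonZero q≢0}}

private abstract
  recip-inverseʳ : ∀ q → 0ℚ ℚ.< q → q ℚ.* recip q ≡ 1ℚ
  recip-inverseʳ q 0<q with q ℚ.≟ 0ℚ
  ... | yes q≡0 = ⊥-elim (ℚ.<-irrefl (sym q≡0) 0<q)
  ... | no q≢0  = ℚ.*-inverseʳ q {{ℚ.≢-nonZero q≢0}}

  -- |1/a - 1/b|·a·b = |b - a|
  recip-close : ∀ a b {ε δ} → 0ℚ ℚ.< δ → 0ℚ ℚ.< ε → δ ℚ.≤ a → δ ℚ.≤ b →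
    ℚ.∣ b ℚ.- a ∣ ℚ.< ε ℚ.* (δ ℚ.* δ) → ℚ.∣ recip a ℚ.- recip b ∣ ℚ.< ε
  recip-close a b {ε} {δ} 0<δ 0<ε δ≤a δ≤b h =
    ℚ.*-cancelʳ-<-nonNeg (a ℚ.* b) {{ℚ.nonNegative 0≤ab}} (begin-strict
      ℚ.∣ recip a ℚ.- recip b ∣ ℚ.* (a ℚ.* b)
        ≡⟨ cong (ℚ.∣ recip a ℚ.- recip b ∣ ℚ.*_) (ℚ.0≤p⇒∣p∣≡p 0≤ab) ⟨
      ℚ.∣ recip a ℚ.- recip b ∣ ℚ.* ℚ.∣ a ℚ.* b ∣
        ≡⟨ ℚ.∣p*q∣≡∣p∣*∣q∣ (recip a ℚ.- recip b) (a ℚ.* b) ⟨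
      ℚ.∣ (recip a ℚ.- recip b) ℚ.* (a ℚ.* b) ∣
        ≡⟨ cong ℚ.∣_∣ (expand a b (recip a) (recip b)) ⟩
      ℚ.∣ a ℚ.* recip a ℚ.* b ℚ.- b ℚ.* recip b ℚ.* a ∣
        ≡⟨ cong ℚ.∣_∣ (cong₂ (λ p q → p ℚ.* b ℚ.- q ℚ.* a)
                        (recip-inverseʳ a 0<a) (recip-inverseʳ b 0<b)) ⟩
      ℚ.∣ 1ℚ ℚ.* b ℚ.- 1ℚ ℚ.* a ∣
        ≡⟨ cong ℚ.∣_∣ (cong₂ ℚ._-_ (ℚ.*-identityˡ b) (ℚ.*-identityˡ a)) ⟩
      ℚ.∣ b ℚ.- a ∣
        <⟨ h ⟩
      ε ℚ.* (δ ℚ.* δ)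
        ≤⟨ ℚ.*-monoˡ-≤-nonNeg ε {{ℚ.nonNegative (ℚ.<⇒≤ 0<ε)}} δδ≤ab ⟩
      ε ℚ.* (a ℚ.* b) ∎)
    where
    open ℚ.≤-Reasoning
    0<a : 0ℚ ℚ.< a
    0<a = ℚ.<-≤-trans 0<δ δ≤a
    0<b : 0ℚ ℚ.< b
    0<b = ℚ.<-≤-trans 0<δ δ≤b
    0≤ab : 0ℚ ℚ.≤ a ℚ.* b
    0≤ab = ℚ.<⇒≤ (0<p*q 0<a 0<b)
    δδ≤ab : δ ℚ.* δ ℚ.≤ a ℚ.* b
    δδ≤ab = ℚ.≤-trans
      (ℚ.*-monoʳ-≤-nonNeg δ {{ℚ.nonNegative (ℚ.<⇒≤ 0<δ)}} δ≤a)
      (ℚ.*-monoˡ-≤-nonNeg a {{ℚ.nonNegative (ℚ.<⇒≤ 0<a)}} δ≤b)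

  recip-cauchy : ∀ y → 0ℝ < y → IsCauchy (λ i → recip (seq y i))
  recip-cauchy y (δ , 0<δ , K , δ≤y) ε 0<ε
    with cauchy y (ε ℚ.* (δ ℚ.* δ)) (0<p*q 0<ε (0<p*q 0<δ 0<δ))
  ... | N , h = K ℕ.⊔ N , λ i j ≤i ≤j →
    recip-close (seq y i) (seq y j) 0<δ 0<ε
      (bound i (ℕ.m⊔n≤o⇒m≤o K N ≤i)) (bound j (ℕ.m⊔n≤o⇒m≤o K N ≤j))
      (h j i (ℕ.m⊔n≤o⇒n≤o K N ≤j) (ℕ.m⊔n≤o⇒n≤o K N ≤i))
    where
    bound : ∀ i → K ℕ.≤ i → δ ℚ.≤ seq y i
    bound i K≤i = subst (ℚ._≤ seq y i) (ℚ.+-identityˡ δ) (δ≤y i K≤i)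

_⁻¹[_] : (y : ℝ) → 0ℝ < y → ℝ
y ⁻¹[ 0<y ] = mkℝ (λ i → recip (seq y i)) (recip-cauchy y 0<y)

infix 7 _÷_[_]

_÷_[_] : ℝ → (y : ℝ) → 0ℝ < y → ℝ
x ÷ y [ 0<y ] = x * y ⁻¹[ 0<y ]

record WeightedGraph (n : ℕ) : Set where
  field
    adjacent   : Fin n → Fin n → Bool
    adj-sym    : ∀ x y → adjacent x y ≡ adjacent y x
    adj-irrefl : ∀ x → adjacent x x ≡ false

  _~_ : Fin n → Fin n → Set
  x ~ y = T (adjacent x y)

  field
    weight     : ∀ x y → x ~ y → ℝ
    weight-sym : ∀ x y (e : x ~ y) (e′ : y ~ x) → weight x y e ≃ weight y x e′
    weight-pos : ∀ x y (e : x ~ y) → 0ℝ < weight x y e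

module _ (G : WeightedGraph n) where
  open WeightedGraph G

  data Walk : Fin n → Fin n → ℕ → Set where
    []  : ∀ {x} → Walk x x 0
    _∷_ : ∀ {x y z k} → x ~ y → Walk y z k → Walk x z (suc k)

  Connected : Set
  Connected = ∀ x y → ∃ (Walk x y)

  IsDistance : Fin n → Fin n → ℕ → Set
  IsDistance x y k = Walk x y k × (∀ j → Walk x y j → k ℕ.≤ j)

  edgeTerm : (Fin n → Fin n → ℝ) → ∀ x y → Dec (x Fin.< y) → Dec (x ~ y) → ℝ
  edgeTerm f x y (yes _) (yes e) = weight x y e * f x y
  edgeTerm f x y _       _       = 0ℝ

  -- Σ_{xy ∈ E} w_xy f(x,y), each unordered edge being listed once, with x < y.
  edgeSum : (Fin n → Fin n → ℝ) → ℝ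
  edgeSum f = sum λ x → sum λ y →
    edgeTerm f x y (x Fin.<? y) (T? (adjacent x y))

K : (n : ℕ) → WeightedGraph n
K n = record
  { adjacent   = λ x y → not ⌊ x Fin.≟ y ⌋
  ; adj-sym    = symmetric
  ; adj-irrefl = irreflexive
  ; weight     = λ _ _ _ → 1ℝ
  ; weight-sym = λ _ _ _ _ ε 0<ε → 0 , λ _ _ → 0<ε
  ; weight-pos = λ _ _ _ → 1ℚ , ℚ.positive⁻¹ 1ℚ , 0 , λ _ _ → ℚ.≤-refl
  }
  where
  symmetric : ∀ x y → not ⌊ x Fin.≟ y ⌋ ≡ not ⌊ y Fin.≟ x ⌋
  symmetric x y with x Fin.≟ y | y Fin.≟ x
  ... | yes _   | yes _   = refl
  ... | no _    | no _    = refl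
  ... | yes x≡y | no y≢x  = ⊥-elim (y≢x (sym x≡y))
  ... | no x≢y  | yes y≡x = ⊥-elim (x≢y (sym y≡x))
  irreflexive : ∀ x → not ⌊ x Fin.≟ x ⌋ ≡ false
  irreflexive x with x Fin.≟ x
  ... | yes _  = refl
  ... | no x≢x = ⊥-elim (x≢x refl)

IsMinimum : {A : Set} → (A → ℝ) → ℝ → Set
IsMinimum cost m = (∃ λ a → cost a ≃ m) × (∀ a → m ≤ cost a)

-- The ordinary triangle inequality follows from the strong one, as u ≥ 0.
IsUltrametric : (Fin n → Fin n → ℝ) → Set
IsUltrametric = IsGeneralMetric _≡_ _≃_ _≤_ 0ℝ _⊔_

record DominatingUltrametric (G : WeightedGraph n) : Set where
  field
    u             : Fin n → Fin n → ℝ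
    isUltrametric : IsUltrametric u
    dominates     : ∀ x y k → IsDistance G x y k → fromℕ k ≤ u x y

IsOPT-free : WeightedGraph n → ℝ → Set
IsOPT-free G = IsMinimum {DominatingUltrametric G} λ U →
  edgeSum G (DominatingUltrametric.u U)

-- A tree is indexed by its root cluster. The two children of a node are
-- listed in some order, which affects no cluster.
data Tree {n : ℕ} : Subset n → Set where
  leaf : ∀ x → Tree ⁅ x ⁆
  node : ∀ {p q} → Empty (p ∩ q) → Tree p → Tree q → Tree (p ∪ q)

Hierarchy : ℕ → Set
Hierarchy n = Tree {n} ⊤

-- The cluster of the lowest common ancestor of two leaves x, y ∈ s; the
-- value is irrelevant when x or y is not a leaf of the tree.
lcaCluster : ∀ {s : Subset n} → Tree s → Fin n → Fin n → Subset n
lcaCluster (leaf z) x y = ⁅ z ⁆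
lcaCluster (node {p} {q} _ l r) x y
  with (x ∈? p) ×-dec (y ∈? p) | (x ∈? q) ×-dec (y ∈? q)
... | yes _ | _     = lcaCluster l x y
... | no _  | yes _ = lcaCluster r x y
... | no _  | no _  = p ∪ q

dasguptaCost : WeightedGraph n → Hierarchy n → ℝ
dasguptaCost G t = edgeSum G λ x y → fromℕ ∣ lcaCluster t x y ∣

IsOPT-D : WeightedGraph n → ℝ → Set
IsOPT-D G = IsMinimum (dasguptaCost G)

factor : ℕ → ℝ
factor n = fromℕ (2 ℕ.* (n ℕ.+ 1)) * fromℚ (+ 1 ℚ./ 3)

{-# OPTIONS --safe #-}
module Submission where

-- The factor comes from averaging over caterpillar trees, the hierarchies that
-- split off one vertex at a time.
--
-- Upper bound. Let D be the least Dasgupta cost, F the least cost of a dominating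
-- ultrametric and W the total edge weight. An ultrametric that dominates the
-- graph distance is at least 1 on every edge, so W ≤ F (totalWeight≤). On the
-- other side 3 D ≤ 2 (n + 1) W (lowerBound-⊑, OPT-D≤), by induction on the size
-- k of a vertex set S. Split off a vertex v first: the edges of S at v cost k
-- times their weight, and the rest is a tree on S without v, to which the
-- induction hypothesis applies (bound-split).
-- Summed over all v in S, the weighted degrees within S give twice the weight
-- within S, and dividing by k yields the bound for S (bound-average). Only
-- addition and the order of the weights are used, so the induction is carried
-- out over an ordered commutative monoid.
--
-- Sharpness. For unit weights the recurrence over a tree gives 3 c + k = k³ for
-- the cost c of every tree with k leaves, and 2 e + k = k² for the number e of
-- pairs (cost-complete, inner-complete). So every hierarchy of the complete
-- graph has cost D with 3 D = 2 (n + 1) W, while the ultrametric with constant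
-- value 1 off the diagonal attains F = W (K-OPT-free). The ratio is therefore
-- exactly 2 (n + 1) / 3.
--
-- Existence of the optima, under excluded middle. Both minima run over finitely
-- many values (minimum-exists). A Dasgupta cost is determined by the sizes of the
-- clusters of lowest common ancestors. A dominating ultrametric can be rounded down to
-- naturals and capped at a bound M for all graph distances: this preserves the
-- strong triangle inequality, keeps it above the graph distance, which is
-- integral, and does not raise the cost (rounded-isIntegral).

open import Defs
open import Axiom.ExcludedMiddle using (ExcludedMiddle)
open import Data.Nat.Base as ℕ using (ℕ; zero; suc; z≤n; s≤s)
open import Data.Product.Base using (Σ; ∃; _×_; _,_; proj₁; proj₂)
open import Level using (0ℓ)

import Data.Nat.Properties as ℕ
open import Algebra.Bundles using (CommutativeMonoid; CommutativeSemiring)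
open import Algebra.Properties.CommutativeMonoid.Sum ℕ.+-0-commutativeMonoid using ()
  renaming (sum to sumℕ; sum-cong-≗ to sumℕ-cong; ∑-distrib-+ to sumℕ-+; ∑-comm to sumℕ-comm)
open import Algebra.Structures.Biased using (isCommutativeSemiringˡ)
open import Data.Bool.Base using (T; not; if_then_else_)
open import Data.Bool.Properties using (T?)
open import Data.Empty using (⊥; ⊥-elim)
open import Data.Fin.Base as Fin using (Fin; toℕ; fromℕ<; finToFun; funToFin)
import Data.Fin.Properties as Fin
open import Data.Fin.Subset
  using (Subset; inside; outside; ⊤; ⁅_⁆; _∩_; _∪_; ∁; _∈_; _∉_; Empty; Nonempty; ∣_∣)
  renaming (⊥ to ∅)
open import Data.Fin.Subset.Properties
open import Data.Integer.Base using (+_)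
open import Data.Nat.Tactic.RingSolver using (solve-∀)
open import Data.Rational.Base as ℚ using (ℚ; 0ℚ; 1ℚ; ½; 1/_)
import Data.Rational.Properties as ℚ
open import Data.Rational.Solver using (module +-*-Solver)
open import Data.Sum.Base using (_⊎_; inj₁; inj₂)
open import Data.Vec.Base using ([]; _∷_; lookup)
open import Data.Vec.Properties using ([]=⇒lookup; lookup⇒[]=)
open import Function.Metric.Structures using (IsGeneralMetric)
open import Relation.Binary.Bundles using (Poset)
open import Relation.Binary.Core using (Rel)
open import Relation.Binary.Definitions using (tri<; tri≈; tri>)
open import Relation.Binary.PropositionalEquality as ≡
  using (_≡_; _≢_; refl; sym; trans; cong; cong₂; subst; module ≡-Reasoning)
import Relation.Binary.Reasoning.PartialOrder as PosetReasoning
import Relation.Binary.Reasoning.Setoid as SetoidReasoning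
open import Relation.Binary.Structures using (IsEquivalence; IsPartialOrder)
open import Relation.Nullary.Decidable using (Dec; yes; no; ⌊_⌋)

private
  variable
    n : ℕ

-- Indicator functions

-- The indicator function of a subset.
χ : Subset n → Fin n → ℕ
χ p x = if lookup p x then 1 else 0

∈⇒χ≡1 : ∀ {p : Subset n} {x} → x ∈ p → χ p x ≡ 1
∈⇒χ≡1 x∈p = cong (if_then 1 else 0) ([]=⇒lookup x∈p)

∉⇒χ≡0 : ∀ (p : Subset n) {x} → x ∉ p → χ p x ≡ 0
∉⇒χ≡0 p {x} x∉p with lookup p x in eq
... | inside  = ⊥-elim (x∉p (lookup⇒[]= x p eq))
... | outside = refl

sum-χ : ∀ (p : Subset n) → sumℕ (χ p) ≡ ∣ p ∣
sum-χ []            = refl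
sum-χ (inside  ∷ p) = cong suc (sum-χ p)
sum-χ (outside ∷ p) = sum-χ p

χ-⁅⁆-sym : ∀ (x y : Fin n) → χ ⁅ x ⁆ y ≡ χ ⁅ y ⁆ x
χ-⁅⁆-sym x y with x Fin.≟ y
... | yes refl = refl
... | no x≢y   = trans (∉⇒χ≡0 ⁅ x ⁆ (λ y∈ → x≢y (sym (x∈⁅y⁆⇒x≡y x y∈))))
                       (sym (∉⇒χ≡0 ⁅ y ⁆ (λ x∈ → x≢y (x∈⁅y⁆⇒x≡y y x∈))))

sum-χ-⁅⁆ : ∀ (x : Fin n) → sumℕ (λ v → χ ⁅ v ⁆ x) ≡ 1
sum-χ-⁅⁆ x = begin
  sumℕ (λ v → χ ⁅ v ⁆ x)   ≡⟨ sumℕ-cong (λ v → χ-⁅⁆-sym v x) ⟩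
  sumℕ (χ ⁅ x ⁆)           ≡⟨ sum-χ ⁅ x ⁆ ⟩
  ∣ ⁅ x ⁆ ∣                ≡⟨ ∣⁅x⁆∣≡1 x ⟩
  1                        ∎
  where open ≡-Reasoning

χ-⁅⁆-* : ∀ (v x y : Fin n) → x ≢ y → χ ⁅ v ⁆ x ℕ.* χ ⁅ v ⁆ y ≡ 0
χ-⁅⁆-* v x y x≢y with v Fin.≟ x
... | yes refl = trans (cong (χ ⁅ v ⁆ v ℕ.*_) (∉⇒χ≡0 ⁅ v ⁆ λ y∈ → x≢y (sym (x∈⁅y⁆⇒x≡y v y∈))))
                       (ℕ.*-zeroʳ (χ ⁅ v ⁆ v))
... | no v≢x   = cong (ℕ._* χ ⁅ v ⁆ y) (∉⇒χ≡0 ⁅ v ⁆ λ x∈ → v≢x (sym (x∈⁅y⁆⇒x≡y v x∈)))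

-- The position of a point relative to two disjoint sets, with the resulting
-- values of the indicator functions.
data Position (p q : Subset n) (x : Fin n) : Set where
  inˡ     : x ∈ p → χ p x ≡ 1 → χ q x ≡ 0 → χ (p ∪ q) x ≡ 1 → Position p q x
  inʳ     : x ∈ q → χ p x ≡ 0 → χ q x ≡ 1 → χ (p ∪ q) x ≡ 1 → Position p q x
  neither : χ p x ≡ 0 → χ q x ≡ 0 → χ (p ∪ q) x ≡ 0 → Position p q x

position : ∀ {p q : Subset n} → Empty (p ∩ q) → ∀ x → Position p q x
position {p = p} {q} p∩q≡∅ x with x ∈? p | x ∈? q
... | yes x∈p | yes x∈q = ⊥-elim (p∩q≡∅ (x , x∈p∩q⁺ (x∈p , x∈q)))
... | yes x∈p | no  x∉q = inˡ x∈p (∈⇒χ≡1 x∈p) (∉⇒χ≡0 q x∉q) (∈⇒χ≡1 (x∈p∪q⁺ (inj₁ x∈p)))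
... | no  x∉p | yes x∈q = inʳ x∈q (∉⇒χ≡0 p x∉p) (∈⇒χ≡1 x∈q) (∈⇒χ≡1 (x∈p∪q⁺ {p = p} (inj₂ x∈q)))
... | no  x∉p | no  x∉q = neither (∉⇒χ≡0 p x∉p) (∉⇒χ≡0 q x∉q) (∉⇒χ≡0 (p ∪ q) outside-both)
  where
  outside-both : x ∉ p ∪ q
  outside-both x∈ with x∈p∪q⁻ p q x∈
  ... | inj₁ x∈p = x∉p x∈p
  ... | inj₂ x∈q = x∉q x∈q

χ-∪ : ∀ {p q : Subset n} → Empty (p ∩ q) → ∀ x → χ (p ∪ q) x ≡ χ p x ℕ.+ χ q x
χ-∪ p∩q≡∅ x with position p∩q≡∅ x
... | inˡ _ a b c = trans c (sym (cong₂ ℕ._+_ a b))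
... | inʳ _ a b c = trans c (sym (cong₂ ℕ._+_ a b))
... | neither a b c = trans c (sym (cong₂ ℕ._+_ a b))

∣p∪q∣≡∣p∣+∣q∣ : ∀ {p q : Subset n} → Empty (p ∩ q) → ∣ p ∪ q ∣ ≡ ∣ p ∣ ℕ.+ ∣ q ∣
∣p∪q∣≡∣p∣+∣q∣ {p = p} {q} p∩q≡∅ = begin
  ∣ p ∪ q ∣                            ≡⟨ sum-χ (p ∪ q) ⟨
  sumℕ (χ (p ∪ q))                     ≡⟨ sumℕ-cong (χ-∪ p∩q≡∅) ⟩
  sumℕ (λ x → χ p x ℕ.+ χ q x)         ≡⟨ sumℕ-+ (χ p) (χ q) ⟩
  sumℕ (χ p) ℕ.+ sumℕ (χ q)            ≡⟨ cong₂ ℕ._+_ (sum-χ p) (sum-χ q) ⟩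
  ∣ p ∣ ℕ.+ ∣ q ∣                      ∎
  where open ≡-Reasoning

-- The set S without the point v.
infixl 5 _∖_
_∖_ : Subset n → Fin n → Subset n
S ∖ v = S ∩ ∁ ⁅ v ⁆

⁅v⁆∩S∖v≡∅ : ∀ (S : Subset n) v → Empty (⁅ v ⁆ ∩ (S ∖ v))
⁅v⁆∩S∖v≡∅ S v (x , x∈) with x∈p∩q⁻ ⁅ v ⁆ (S ∖ v) x∈
... | x∈v , x∈S∖v = x∈∁p⇒x∉p (proj₂ (x∈p∩q⁻ S (∁ ⁅ v ⁆) x∈S∖v)) x∈v

⁅v⁆∪S∖v≡S : ∀ {S : Subset n} {v} → v ∈ S → ⁅ v ⁆ ∪ (S ∖ v) ≡ S
⁅v⁆∪S∖v≡S {S = S} {v} v∈S = ⊆-antisym to from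
  where
  to : ∀ {x} → x ∈ ⁅ v ⁆ ∪ (S ∖ v) → x ∈ S
  to x∈ with x∈p∪q⁻ ⁅ v ⁆ (S ∖ v) x∈
  ... | inj₁ x∈v   = subst (_∈ S) (sym (x∈⁅y⁆⇒x≡y v x∈v)) v∈S
  ... | inj₂ x∈S∖v = proj₁ (x∈p∩q⁻ S (∁ ⁅ v ⁆) x∈S∖v)
  from : ∀ {x} → x ∈ S → x ∈ ⁅ v ⁆ ∪ (S ∖ v)
  from {x} x∈S with x ∈? ⁅ v ⁆
  ... | yes x∈v = x∈p∪q⁺ (inj₁ x∈v)
  ... | no  x∉v = x∈p∪q⁺ {p = ⁅ v ⁆} (inj₂ (x∈p∩q⁺ (x∈S , x∉p⇒x∈∁p x∉v)))

∣S∣≡1+∣S∖v∣ : ∀ {S : Subset n} {v} → v ∈ S → ∣ S ∣ ≡ suc ∣ S ∖ v ∣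
∣S∣≡1+∣S∖v∣ {S = S} {v} v∈S = begin
  ∣ S ∣                        ≡⟨ cong ∣_∣ (⁅v⁆∪S∖v≡S v∈S) ⟨
  ∣ ⁅ v ⁆ ∪ (S ∖ v) ∣          ≡⟨ ∣p∪q∣≡∣p∣+∣q∣ (⁅v⁆∩S∖v≡∅ S v) ⟩
  ∣ ⁅ v ⁆ ∣ ℕ.+ ∣ S ∖ v ∣      ≡⟨ cong (ℕ._+ ∣ S ∖ v ∣) (∣⁅x⁆∣≡1 v) ⟩
  suc ∣ S ∖ v ∣                ∎
  where open ≡-Reasoning

χ-∖ : ∀ (S : Subset n) {v y} → v ≢ y → χ (S ∖ v) y ≡ χ S y
χ-∖ S {v} {y} v≢y with y ∈? S
... | yes y∈S = trans (∈⇒χ≡1 (x∈p∩q⁺ (y∈S , x∉p⇒x∈∁p λ y∈v → v≢y (sym (x∈⁅y⁆⇒x≡y v y∈v)))))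
                      (sym (∈⇒χ≡1 y∈S))
... | no y∉S  = trans (∉⇒χ≡0 (S ∖ v) (λ y∈ → y∉S (proj₁ (x∈p∩q⁻ S (∁ ⁅ v ⁆) y∈))))
                      (sym (∉⇒χ≡0 S y∉S))

∣S∣≡1+k⇒Nonempty : ∀ (S : Subset n) {k} → ∣ S ∣ ≡ suc k → Nonempty S
∣S∣≡1+k⇒Nonempty {n = n} S eq with nonempty? S
... | yes ne = ne
... | no  e  with trans (sym eq) (trans (cong ∣_∣ (Empty-unique e)) (∣⊥∣≡0 n))
...   | ()

∣S∣≡1⇒S≡⁅v⁆ : ∀ (S : Subset n) → ∣ S ∣ ≡ 1 → ∃ λ v → ⁅ v ⁆ ≡ S
∣S∣≡1⇒S≡⁅v⁆ S ∣S∣≡1 with ∣S∣≡1+k⇒Nonempty S ∣S∣≡1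
... | v , v∈S = v , (begin
  ⁅ v ⁆                ≡⟨ ∪-identityʳ ⁅ v ⁆ ⟨
  ⁅ v ⁆ ∪ ∅            ≡⟨ cong (⁅ v ⁆ ∪_) (Empty-unique empty) ⟨
  ⁅ v ⁆ ∪ (S ∖ v)      ≡⟨ ⁅v⁆∪S∖v≡S v∈S ⟩
  S                    ∎)
  where
  open ≡-Reasoning
  empty : Empty (S ∖ v)
  empty (x , x∈) with trans (sym ∣S∣≡1) (trans (∣S∣≡1+∣S∖v∣ v∈S) (cong suc (∣S∣≡1+∣S∖v∣ x∈)))
  ... | ()

-- Sizes of lowest common ancestors

-- The size of the cluster of the lowest common ancestor of x and y, counted
-- as 0 unless both points are leaves of the tree. With this convention it can
-- be summed over all pairs of points, whatever the leaf set s.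
lcaSize : ∀ {s : Subset n} → Tree s → Fin n → Fin n → ℕ
lcaSize {s = s} t x y = χ s x ℕ.* χ s y ℕ.* ∣ lcaCluster t x y ∣

-- The indicator function of the ordered pairs joining two disjoint sets.
cross : Subset n → Subset n → Fin n → Fin n → ℕ
cross p q x y = χ p x ℕ.* χ q y ℕ.+ χ q x ℕ.* χ p y

-- The indicator function of the ordered pairs within p.
within : Subset n → Fin n → Fin n → ℕ
within p x y = χ p x ℕ.* χ p y

within-∪ : ∀ {p q : Subset n} → Empty (p ∩ q) → ∀ x y →
           within (p ∪ q) x y ≡ within p x y ℕ.+ within q x y ℕ.+ cross p q x y
within-∪ {p = p} {q} p∩q≡∅ x y = begin
  χ (p ∪ q) x ℕ.* χ (p ∪ q) y
    ≡⟨ cong₂ ℕ._*_ (χ-∪ p∩q≡∅ x) (χ-∪ p∩q≡∅ y) ⟩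
  (χ p x ℕ.+ χ q x) ℕ.* (χ p y ℕ.+ χ q y)
    ≡⟨ expand (χ p x) (χ q x) (χ p y) (χ q y) ⟩
  within p x y ℕ.+ within q x y ℕ.+ cross p q x y ∎
  where
  open ≡-Reasoning
  expand : ∀ a b c d → (a ℕ.+ b) ℕ.* (c ℕ.+ d) ≡ a ℕ.* c ℕ.+ b ℕ.* d ℕ.+ (a ℕ.* d ℕ.+ b ℕ.* c)
  expand = solve-∀

module _ {p q : Subset n} (p∩q≡∅ : Empty (p ∩ q)) (l : Tree p) (r : Tree q) where

  private
    t : Tree (p ∪ q)
    t = node p∩q≡∅ l r

    apart : ∀ {x} → x ∈ p → x ∉ q
    apart x∈p x∈q = p∩q≡∅ (_ , x∈p∩q⁺ (x∈p , x∈q))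

    k+0≡k*1 : ∀ k → k ℕ.+ 0 ≡ k ℕ.* 1
    k+0≡k*1 = solve-∀

  lca-within-l : ∀ {x y} → x ∈ p → y ∈ p → lcaCluster t x y ≡ lcaCluster l x y
  lca-within-l {x} {y} x∈p y∈p with x ∈? p | y ∈? p
  ... | yes _   | yes _   = refl
  ... | no x∉p  | _       = ⊥-elim (x∉p x∈p)
  ... | yes _   | no y∉p  = ⊥-elim (y∉p y∈p)

  lca-within-r : ∀ {x y} → x ∈ q → y ∈ q → lcaCluster t x y ≡ lcaCluster r x y
  lca-within-r {x} {y} x∈q y∈q with x ∈? p | y ∈? p | x ∈? q | y ∈? q
  ... | yes x∈p | _ | _      | _      = ⊥-elim (apart x∈p x∈q)
  ... | no _    | _ | yes _  | yes _  = refl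
  ... | no _    | _ | no x∉q | _      = ⊥-elim (x∉q x∈q)
  ... | no _    | _ | yes _  | no y∉q = ⊥-elim (y∉q y∈q)

  lca-across-lr : ∀ {x y} → x ∈ p → y ∈ q → lcaCluster t x y ≡ p ∪ q
  lca-across-lr {x} {y} x∈p y∈q with x ∈? p | y ∈? p | x ∈? q | y ∈? q
  ... | _      | yes y∈p | _       | _ = ⊥-elim (apart y∈p y∈q)
  ... | _      | _       | yes x∈q | _ = ⊥-elim (apart x∈p x∈q)
  ... | yes _  | no _    | no _    | _ = refl
  ... | no x∉p | _       | _       | _ = ⊥-elim (x∉p x∈p)

  lca-across-rl : ∀ {x y} → x ∈ q → y ∈ p → lcaCluster t x y ≡ p ∪ q
  lca-across-rl {x} {y} x∈q y∈p with x ∈? p | y ∈? p | x ∈? q | y ∈? q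
  ... | yes x∈p | _      | _     | _       = ⊥-elim (apart x∈p x∈q)
  ... | _       | _      | _     | yes y∈q = ⊥-elim (apart y∈p y∈q)
  ... | no _    | yes _  | yes _ | no _    = refl
  ... | _       | no y∉p | _     | _       = ⊥-elim (y∉p y∈p)
  ... | _       | _      | no x∉q | _      = ⊥-elim (x∉q x∈q)

  -- Two leaves of the tree lie in the same child or are separated at the root,
  -- where the cluster has size |p| + |q|.
  lcaSize-node : ∀ x y → lcaSize t x y ≡
    lcaSize l x y ℕ.+ lcaSize r x y ℕ.+ (∣ p ∣ ℕ.+ ∣ q ∣) ℕ.* cross p q x y
  lcaSize-node x y with position p∩q≡∅ x | position p∩q≡∅ y
  ... | inˡ x∈ a b c | inˡ y∈ a′ b′ c′
    rewrite a | b | c | a′ | b′ | c′ | lca-within-l x∈ y∈ =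
    collectˡ ∣ lcaCluster l x y ∣ (∣ p ∣ ℕ.+ ∣ q ∣)
    where
    collectˡ : ∀ u k → u ℕ.+ 0 ≡ u ℕ.+ 0 ℕ.+ 0 ℕ.+ k ℕ.* 0
    collectˡ = solve-∀
  ... | inˡ x∈ a b c | inʳ y∈ a′ b′ c′
    rewrite a | b | c | a′ | b′ | c′ | lca-across-lr x∈ y∈ | ∣p∪q∣≡∣p∣+∣q∣ p∩q≡∅ =
    k+0≡k*1 (∣ p ∣ ℕ.+ ∣ q ∣)
  ... | inʳ x∈ a b c | inˡ y∈ a′ b′ c′
    rewrite a | b | c | a′ | b′ | c′ | lca-across-rl x∈ y∈ | ∣p∪q∣≡∣p∣+∣q∣ p∩q≡∅ =
    k+0≡k*1 (∣ p ∣ ℕ.+ ∣ q ∣)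
  ... | inʳ x∈ a b c | inʳ y∈ a′ b′ c′
    rewrite a | b | c | a′ | b′ | c′ | lca-within-r x∈ y∈ =
    collectʳ ∣ lcaCluster r x y ∣ (∣ p ∣ ℕ.+ ∣ q ∣)
    where
    collectʳ : ∀ u k → u ℕ.+ 0 ≡ u ℕ.+ 0 ℕ.+ k ℕ.* 0
    collectʳ = solve-∀
  ... | neither a b c | _
    rewrite a | b | c = sym (ℕ.*-zeroʳ (∣ p ∣ ℕ.+ ∣ q ∣))
  ... | inˡ _ a b c | neither a′ b′ c′
    rewrite a | b | c | a′ | b′ | c′ = sym (ℕ.*-zeroʳ (∣ p ∣ ℕ.+ ∣ q ∣))
  ... | inʳ _ a b c | neither a′ b′ c′
    rewrite a | b | c | a′ | b′ | c′ = sym (ℕ.*-zeroʳ (∣ p ∣ ℕ.+ ∣ q ∣))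

-- A pair of distinct points of S is separated by splitting off a vertex of S in
-- exactly two cases, namely when that vertex is one of its ends.
sum-cross-∖ : ∀ (S : Subset n) {x y} → x ≢ y →
  sumℕ (λ v → χ S v ℕ.* cross ⁅ v ⁆ (S ∖ v) x y) ≡ 2 ℕ.* within S x y
sum-cross-∖ S {x} {y} x≢y = begin
  sumℕ (λ v → χ S v ℕ.* cross ⁅ v ⁆ (S ∖ v) x y)
    ≡⟨ sumℕ-cong term ⟩
  sumℕ (λ v → χ ⁅ v ⁆ x ℕ.* w ℕ.+ χ ⁅ v ⁆ y ℕ.* w)
    ≡⟨ sumℕ-+ (λ v → χ ⁅ v ⁆ x ℕ.* w) (λ v → χ ⁅ v ⁆ y ℕ.* w) ⟩
  sumℕ (λ v → χ ⁅ v ⁆ x ℕ.* w) ℕ.+ sumℕ (λ v → χ ⁅ v ⁆ y ℕ.* w)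
    ≡⟨ cong₂ ℕ._+_ (*-distribʳ-sum w (λ v → χ ⁅ v ⁆ x)) (*-distribʳ-sum w (λ v → χ ⁅ v ⁆ y)) ⟨
  sumℕ (λ v → χ ⁅ v ⁆ x) ℕ.* w ℕ.+ sumℕ (λ v → χ ⁅ v ⁆ y) ℕ.* w
    ≡⟨ cong₂ (λ a b → a ℕ.* w ℕ.+ b ℕ.* w) (sum-χ-⁅⁆ x) (sum-χ-⁅⁆ y) ⟩
  1 ℕ.* w ℕ.+ 1 ℕ.* w
    ≡⟨ ℕ.*-distribʳ-+ w 1 1 ⟨
  2 ℕ.* w ∎
  where
  open ≡-Reasoning
  open import Algebra.Properties.Semiring.Sum ℕ.+-*-semiring using (*-distribʳ-sum)
  w = within S x y
  assoc-comm : ∀ a b c → a ℕ.* (b ℕ.* c) ≡ b ℕ.* (a ℕ.* c)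
  assoc-comm = solve-∀
  assoc-comm′ : ∀ a b c → a ℕ.* (b ℕ.* c) ≡ c ℕ.* (b ℕ.* a)
  assoc-comm′ = solve-∀
  firstTerm : ∀ v → χ S v ℕ.* (χ ⁅ v ⁆ x ℕ.* χ (S ∖ v) y) ≡ χ ⁅ v ⁆ x ℕ.* w
  firstTerm v with v Fin.≟ x
  ... | yes refl = trans (assoc-comm (χ S v) (χ ⁅ v ⁆ v) (χ (S ∖ v) y))
                     (cong (λ c → χ ⁅ v ⁆ v ℕ.* (χ S v ℕ.* c)) (χ-∖ S x≢y))
  ... | no v≢x rewrite ∉⇒χ≡0 ⁅ v ⁆ (λ x∈ → v≢x (sym (x∈⁅y⁆⇒x≡y v x∈))) = ℕ.*-zeroʳ (χ S v)
  secondTerm : ∀ v → χ S v ℕ.* (χ (S ∖ v) x ℕ.* χ ⁅ v ⁆ y) ≡ χ ⁅ v ⁆ y ℕ.* w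
  secondTerm v with v Fin.≟ y
  ... | yes refl = trans (assoc-comm′ (χ S v) (χ (S ∖ v) x) (χ ⁅ v ⁆ v))
                     (cong (λ c → χ ⁅ v ⁆ v ℕ.* (c ℕ.* χ S v)) (χ-∖ S λ v≡x → x≢y (sym v≡x)))
  ... | no v≢y rewrite ∉⇒χ≡0 ⁅ v ⁆ (λ y∈ → v≢y (sym (x∈⁅y⁆⇒x≡y v y∈)))
                     | ℕ.*-zeroʳ (χ (S ∖ v) x) = ℕ.*-zeroʳ (χ S v)
  term : ∀ v → χ S v ℕ.* cross ⁅ v ⁆ (S ∖ v) x y ≡ χ ⁅ v ⁆ x ℕ.* w ℕ.+ χ ⁅ v ⁆ y ℕ.* w
  term v = trans (ℕ.*-distribˡ-+ (χ S v) _ _) (cong₂ ℕ._+_ (firstTerm v) (secondTerm v))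

-- Weighted sums over pairs

-- Weights live in a commutative monoid, where they can be summed and
-- multiplied by natural numbers. This generality serves real weights as well as
-- natural ones.
module Pairing (M : CommutativeMonoid 0ℓ 0ℓ) where

  open CommutativeMonoid M renaming
    ( Carrier to W; _∙_ to _⊕_; ε to 0#; ∙-cong to ⊕-cong; ∙-congˡ to ⊕-congˡ
    ; ∙-congʳ to ⊕-congʳ; identityˡ to ⊕-identityˡ; identityʳ to ⊕-identityʳ
    ; assoc to ⊕-assoc; comm to ⊕-comm
    ; refl to ≈-refl; sym to ≈-sym; trans to ≈-trans)
  open import Algebra.Properties.CommutativeMonoid.Mult M renaming (_×_ to _·_)
  open import Algebra.Properties.CommutativeMonoid.Sum M
  open SetoidReasoning setoid

  ×-zeroʳ : ∀ k → k · 0# ≈ 0#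
  ×-zeroʳ zero    = ≈-refl
  ×-zeroʳ (suc k) = ≈-trans (⊕-identityˡ (k · 0#)) (×-zeroʳ k)

  sum-cong : ∀ {f g : Fin n → W} → (∀ i → f i ≈ g i) → sum f ≈ sum g
  sum-cong = sum-cong-≋

  sum-× : ∀ k (f : Fin n → W) → sum (λ i → k · f i) ≈ k · sum f
  sum-× {zero}  k f = ≈-sym (×-zeroʳ k)
  sum-× {suc n} k f = ≈-trans (⊕-congˡ (sum-× k (λ i → f (Fin.suc i))))
    (≈-sym (×-distrib-+ (f Fin.zero) (sum λ i → f (Fin.suc i)) k))

  sum-×-const : ∀ (k : Fin n → ℕ) x → sum (λ i → k i · x) ≈ sumℕ k · x
  sum-×-const {zero}  k x = ≈-refl
  sum-×-const {suc n} k x = ≈-trans (⊕-congˡ (sum-×-const (λ i → k (Fin.suc i)) x))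
    (≈-sym (×-homo-+ x (k Fin.zero) (sumℕ λ i → k (Fin.suc i))))

  -- The sum of c(x,y) ω(x,y) over all ordered pairs (x,y).
  ⟨_∣_⟩ : (Fin n → Fin n → W) → (Fin n → Fin n → ℕ) → W
  ⟨ ω ∣ c ⟩ = sum λ x → sum λ y → c x y · ω x y

  module _ (ω : Fin n → Fin n → W) where

    ⟨∣⟩-+ : ∀ c d → ⟨ ω ∣ (λ x y → c x y ℕ.+ d x y) ⟩ ≈ ⟨ ω ∣ c ⟩ ⊕ ⟨ ω ∣ d ⟩
    ⟨∣⟩-+ c d = begin
      sum (λ x → sum λ y → (c x y ℕ.+ d x y) · ω x y)
        ≈⟨ sum-cong (λ x → sum-cong λ y → ×-homo-+ (ω x y) (c x y) (d x y)) ⟩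
      sum (λ x → sum λ y → c x y · ω x y ⊕ d x y · ω x y)
        ≈⟨ sum-cong (λ x → ∑-distrib-+ (λ y → c x y · ω x y) (λ y → d x y · ω x y)) ⟩
      sum (λ x → sum (λ y → c x y · ω x y) ⊕ sum (λ y → d x y · ω x y))
        ≈⟨ ∑-distrib-+ (λ x → sum λ y → c x y · ω x y) (λ x → sum λ y → d x y · ω x y) ⟩
      ⟨ ω ∣ c ⟩ ⊕ ⟨ ω ∣ d ⟩ ∎

    ⟨∣⟩-* : ∀ k c → ⟨ ω ∣ (λ x y → k ℕ.* c x y) ⟩ ≈ k · ⟨ ω ∣ c ⟩
    ⟨∣⟩-* k c = begin
      sum (λ x → sum λ y → (k ℕ.* c x y) · ω x y)
        ≈⟨ sum-cong (λ x → sum-cong λ y → ×-assocˡ (ω x y) k (c x y)) ⟨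
      sum (λ x → sum λ y → k · (c x y · ω x y))
        ≈⟨ sum-cong (λ x → sum-× k λ y → c x y · ω x y) ⟩
      sum (λ x → k · sum λ y → c x y · ω x y)
        ≈⟨ sum-× k (λ x → sum λ y → c x y · ω x y) ⟩
      k · ⟨ ω ∣ c ⟩ ∎

    ⟨∣⟩-sum : ∀ {m} (c : Fin m → Fin n → Fin n → ℕ) →
      sum (λ v → ⟨ ω ∣ c v ⟩) ≈ ⟨ ω ∣ (λ x y → sumℕ λ v → c v x y) ⟩
    ⟨∣⟩-sum c = begin
      sum (λ v → sum λ x → sum λ y → c v x y · ω x y)
        ≈⟨ ∑-comm (λ v x → sum λ y → c v x y · ω x y) ⟩
      sum (λ x → sum λ v → sum λ y → c v x y · ω x y)
        ≈⟨ sum-cong (λ x → ∑-comm (λ v y → c v x y · ω x y)) ⟩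
      sum (λ x → sum λ y → sum λ v → c v x y · ω x y)
        ≈⟨ sum-cong (λ x → sum-cong λ y → sum-×-const (λ v → c v x y) (ω x y)) ⟩
      ⟨ ω ∣ (λ x y → sumℕ λ v → c v x y) ⟩ ∎

  -- Weights that vanish on the diagonal, so that the diagonal entries of c do not
  -- matter. No symmetry is assumed: an edge may carry its weight on either one of
  -- its two ordered pairs.
  module Offdiagonal (ω : Fin n → Fin n → W) (ω-diagonal : ∀ x → ω x x ≈ 0#) where

    ⟨∣⟩-cong : ∀ {c d} → (∀ {x y} → x ≢ y → c x y ≡ d x y) → ⟨ ω ∣ c ⟩ ≈ ⟨ ω ∣ d ⟩
    ⟨∣⟩-cong {c} {d} c≗d = sum-cong λ x → sum-cong λ y → term x y
      where
      term : ∀ x y → c x y · ω x y ≈ d x y · ω x y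
      term x y with x Fin.≟ y
      ... | no x≢y     = ×-congˡ (c≗d x≢y)
      ... | yes refl   = ≈-trans (diagonal (c x x)) (≈-sym (diagonal (d x x)))
        where
        diagonal : ∀ k → k · ω x x ≈ 0#
        diagonal k = ≈-trans (×-congʳ k (ω-diagonal x)) (×-zeroʳ k)

    ⟨∣0⟩ : ⟨ ω ∣ (λ _ _ → 0) ⟩ ≈ 0#
    ⟨∣0⟩ = ⟨∣⟩-* ω 0 (λ _ _ → 0)

    -- The Dasgupta cost of a tree, restricted to the pairs of its leaves.
    cost : ∀ {s : Subset n} → Tree s → W
    cost t = ⟨ ω ∣ lcaSize t ⟩

    -- The total weight within s.
    inner : Subset n → W
    inner s = ⟨ ω ∣ within s ⟩

    -- The total weight between two disjoint sets p and q.
    cut : Subset n → Subset n → W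
    cut p q = ⟨ ω ∣ cross p q ⟩

    inner-⁅⁆ : ∀ v → inner ⁅ v ⁆ ≈ 0#
    inner-⁅⁆ v = ≈-trans (⟨∣⟩-cong λ {x} {y} → χ-⁅⁆-* v x y) ⟨∣0⟩

    cost-leaf : ∀ v → cost (leaf v) ≈ 0#
    cost-leaf v = ≈-trans
      (⟨∣⟩-cong λ {x} {y} x≢y → cong (ℕ._* ∣ ⁅ v ⁆ ∣) (χ-⁅⁆-* v x y x≢y)) ⟨∣0⟩

    inner-∪ : ∀ {p q} → Empty (p ∩ q) → inner (p ∪ q) ≈ inner p ⊕ inner q ⊕ cut p q
    inner-∪ {p} {q} p∩q≡∅ = begin
      inner (p ∪ q)
        ≈⟨ ⟨∣⟩-cong (λ {x} {y} _ → within-∪ p∩q≡∅ x y) ⟩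
      ⟨ ω ∣ (λ x y → within p x y ℕ.+ within q x y ℕ.+ cross p q x y) ⟩
        ≈⟨ ⟨∣⟩-+ ω (λ x y → within p x y ℕ.+ within q x y) (cross p q) ⟩
      ⟨ ω ∣ (λ x y → within p x y ℕ.+ within q x y) ⟩ ⊕ cut p q
        ≈⟨ ⊕-congʳ (⟨∣⟩-+ ω (within p) (within q)) ⟩
      inner p ⊕ inner q ⊕ cut p q ∎

    cost-node : ∀ {p q} (p∩q≡∅ : Empty (p ∩ q)) (l : Tree p) (r : Tree q) →
      cost (node p∩q≡∅ l r) ≈ cost l ⊕ cost r ⊕ (∣ p ∣ ℕ.+ ∣ q ∣) · cut p q
    cost-node {p} {q} p∩q≡∅ l r = begin
      cost (node p∩q≡∅ l r)
        ≈⟨ ⟨∣⟩-cong (λ {x} {y} _ → lcaSize-node p∩q≡∅ l r x y) ⟩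
      ⟨ ω ∣ (λ x y → lcaSize l x y ℕ.+ lcaSize r x y ℕ.+ k ℕ.* cross p q x y) ⟩
        ≈⟨ ⟨∣⟩-+ ω (λ x y → lcaSize l x y ℕ.+ lcaSize r x y) (λ x y → k ℕ.* cross p q x y) ⟩
      ⟨ ω ∣ (λ x y → lcaSize l x y ℕ.+ lcaSize r x y) ⟩ ⊕ ⟨ ω ∣ (λ x y → k ℕ.* cross p q x y) ⟩
        ≈⟨ ⊕-cong (⟨∣⟩-+ ω (lcaSize l) (lcaSize r)) (⟨∣⟩-* ω k (cross p q)) ⟩
      cost l ⊕ cost r ⊕ k · cut p q ∎
      where
      k = ∣ p ∣ ℕ.+ ∣ q ∣

    -- The weighted degrees within S add up to twice the weight within S.
    sum-cut-∖ : ∀ S → sum (λ v → χ S v · cut ⁅ v ⁆ (S ∖ v)) ≈ 2 · inner S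
    sum-cut-∖ S = begin
      sum (λ v → χ S v · cut ⁅ v ⁆ (S ∖ v))
        ≈⟨ sum-cong (λ v → ⟨∣⟩-* ω (χ S v) (cross ⁅ v ⁆ (S ∖ v))) ⟨
      sum (λ v → ⟨ ω ∣ (λ x y → χ S v ℕ.* cross ⁅ v ⁆ (S ∖ v) x y) ⟩)
        ≈⟨ ⟨∣⟩-sum ω (λ v x y → χ S v ℕ.* cross ⁅ v ⁆ (S ∖ v) x y) ⟩
      ⟨ ω ∣ (λ x y → sumℕ λ v → χ S v ℕ.* cross ⁅ v ⁆ (S ∖ v) x y) ⟩
        ≈⟨ ⟨∣⟩-cong (sum-cross-∖ S) ⟩
      ⟨ ω ∣ (λ x y → 2 ℕ.* within S x y) ⟩
        ≈⟨ ⟨∣⟩-* ω 2 (within S) ⟩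
      2 · inner S ∎

-- Averaging over caterpillar trees

-- The order needs no relation to multiplication: monotone addition and the
-- cancellation of positive multiples suffice.
module Averaging (M : CommutativeMonoid 0ℓ 0ℓ) where

  open CommutativeMonoid M renaming
    ( Carrier to W; _∙_ to _⊕_; ε to 0#; ∙-cong to ⊕-cong; ∙-congˡ to ⊕-congˡ
    ; ∙-congʳ to ⊕-congʳ; identityˡ to ⊕-identityˡ; identityʳ to ⊕-identityʳ
    ; assoc to ⊕-assoc; comm to ⊕-comm
    ; refl to ≈-refl; sym to ≈-sym; trans to ≈-trans)
  open import Algebra.Properties.CommutativeMonoid.Mult M renaming (_×_ to _·_)
  open import Algebra.Properties.CommutativeMonoid.Sum M using (sum; ∑-distrib-+)
  open Pairing M

  module OrderedWeights
    (_⊑_ : Rel W 0ℓ) (⊑-isPartialOrder : IsPartialOrder _≈_ _⊑_)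
    (⊕-mono-⊑ : ∀ {x y x′ y′} → x ⊑ y → x′ ⊑ y′ → (x ⊕ x′) ⊑ (y ⊕ y′))
    (×-cancel-⊑ : ∀ k {x y} → (suc k · x) ⊑ (suc k · y) → x ⊑ y)
    where

    private
      ⊑-poset : Poset 0ℓ 0ℓ 0ℓ
      ⊑-poset = record { isPartialOrder = ⊑-isPartialOrder }

      open IsPartialOrder ⊑-isPartialOrder using ()
        renaming (refl to ⊑-refl; reflexive to ⊑-reflexive; trans to ⊑-trans)

      module ⊑-Reasoning = PosetReasoning ⊑-poset

    sum-mono : ∀ {m} {f g : Fin m → W} → (∀ i → f i ⊑ g i) → sum f ⊑ sum g
    sum-mono {zero}  f⊑g = ⊑-refl
    sum-mono {suc m} f⊑g = ⊕-mono-⊑ (f⊑g Fin.zero) (sum-mono λ i → f⊑g (Fin.suc i))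

    module Caterpillars (ω : Fin n → Fin n → W) (ω-diagonal : ∀ x → ω x x ≈ 0#) where

      open Offdiagonal ω ω-diagonal

      -- If m is a lower bound for the costs of all trees on S, then 3 m is at most
      -- 2 (|S| + 1) times the weight within S. The term r makes the statement
      -- inductive without subtraction: it collects the cost of the vertices
      -- already split off.
      Bound : W → Subset n → Set
      Bound m S = ∀ r → (∀ (t : Tree S) → m ⊑ (cost t ⊕ r)) →
        (3 · m) ⊑ ((2 ℕ.* suc ∣ S ∣) · inner S ⊕ 3 · r)

      bound-⁅⁆ : ∀ m v → Bound m ⁅ v ⁆
      bound-⁅⁆ m v r m⊑ = begin
        3 · m                      ≤⟨ ⊕-mono-⊑ m⊑r (⊕-mono-⊑ m⊑r (⊕-mono-⊑ m⊑r ⊑-refl)) ⟩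
        3 · r                      ≈⟨ ⊕-identityˡ (3 · r) ⟨
        0# ⊕ 3 · r                 ≈⟨ ⊕-congʳ (×-zeroʳ k) ⟨
        k · 0# ⊕ 3 · r             ≈⟨ ⊕-congʳ (×-congʳ k (inner-⁅⁆ v)) ⟨
        k · inner ⁅ v ⁆ ⊕ 3 · r    ∎
        where
        open ⊑-Reasoning
        k = 2 ℕ.* suc ∣ ⁅ v ⁆ ∣
        m⊑r : m ⊑ r
        m⊑r = ⊑-trans (m⊑ (leaf v)) (⊑-reflexive (≈-trans (⊕-congʳ (cost-leaf v)) (⊕-identityˡ r)))

      -- Trees whose root splits off v: all edges at v have a cluster of size
      -- k = |q| + 1, and the rest is an arbitrary tree on q.
      bound-split : ∀ m v q → Empty (⁅ v ⁆ ∩ q) → Bound m q → ∀ r →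
        (∀ (t : Tree (⁅ v ⁆ ∪ q)) → m ⊑ (cost t ⊕ r)) → let k = suc ∣ q ∣ in
        (3 · m) ⊑ ((2 ℕ.* k) · inner (⁅ v ⁆ ∪ q) ⊕ 3 · r ⊕ k · cut ⁅ v ⁆ q)
      bound-split m v q v∩q≡∅ bound r m⊑ = begin
        3 · m
          ≤⟨ bound (k · d ⊕ r) m⊑′ ⟩
        (2 ℕ.* k) · inner q ⊕ 3 · (k · d ⊕ r)
          ≈⟨ ⊕-congˡ (×-distrib-+ (k · d) r 3) ⟩
        (2 ℕ.* k) · inner q ⊕ (3 · (k · d) ⊕ 3 · r)
          ≈⟨ ⊕-congˡ (⊕-congʳ (≈-trans (×-homo-+ (k · d) 2 1)
               (⊕-cong (×-assocˡ d 2 k) (×-homo-1 (k · d))))) ⟩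
        (2 ℕ.* k) · inner q ⊕ ((2 ℕ.* k) · d ⊕ k · d ⊕ 3 · r)
          ≈⟨ ⊕-congˡ (≈-trans (⊕-assoc _ _ _) (⊕-congˡ (⊕-comm (k · d) (3 · r)))) ⟩
        (2 ℕ.* k) · inner q ⊕ ((2 ℕ.* k) · d ⊕ (3 · r ⊕ k · d))
          ≈⟨ ⊕-assoc _ _ _ ⟨
        (2 ℕ.* k) · inner q ⊕ (2 ℕ.* k) · d ⊕ (3 · r ⊕ k · d)
          ≈⟨ ⊕-congʳ (×-distrib-+ (inner q) d (2 ℕ.* k)) ⟨
        (2 ℕ.* k) · (inner q ⊕ d) ⊕ (3 · r ⊕ k · d)
          ≈⟨ ⊕-congʳ (×-congʳ (2 ℕ.* k) inner-split) ⟨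
        (2 ℕ.* k) · inner (⁅ v ⁆ ∪ q) ⊕ (3 · r ⊕ k · d)
          ≈⟨ ⊕-assoc _ _ _ ⟨
        (2 ℕ.* k) · inner (⁅ v ⁆ ∪ q) ⊕ 3 · r ⊕ k · d ∎
        where
        open ⊑-Reasoning
        k = suc ∣ q ∣
        d = cut ⁅ v ⁆ q
        inner-split : inner (⁅ v ⁆ ∪ q) ≈ inner q ⊕ d
        inner-split = ≈-trans (inner-∪ v∩q≡∅)
          (⊕-congʳ (≈-trans (⊕-congʳ (inner-⁅⁆ v)) (⊕-identityˡ (inner q))))
        cost-split : ∀ t → cost (node v∩q≡∅ (leaf v) t) ≈ cost t ⊕ k · d
        cost-split t = ≈-trans (cost-node v∩q≡∅ (leaf v) t)
          (⊕-cong (≈-trans (⊕-congʳ (cost-leaf v)) (⊕-identityˡ (cost t)))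
                  (×-congˡ (cong (ℕ._+ ∣ q ∣) (∣⁅x⁆∣≡1 v))))
        m⊑′ : ∀ t → m ⊑ (cost t ⊕ (k · d ⊕ r))
        m⊑′ t = ⊑-trans (m⊑ (node v∩q≡∅ (leaf v) t))
          (⊑-reflexive (≈-trans (⊕-congʳ (cost-split t)) (⊕-assoc (cost t) (k · d) r)))

      -- The bounds obtained by splitting off v are added up over all v ∈ S, and
      -- the factor |S| is then cancelled.
      bound-average : ∀ m S k → ∣ S ∣ ≡ suc k → ∀ r →
        (∀ v → v ∈ S →
          (3 · m) ⊑ ((2 ℕ.* ∣ S ∣) · inner S ⊕ 3 · r ⊕ ∣ S ∣ · cut ⁅ v ⁆ (S ∖ v))) →
        (3 · m) ⊑ ((2 ℕ.* suc ∣ S ∣) · inner S ⊕ 3 · r)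
      bound-average m S k ∣S∣≡1+k r each = ⊑-trans (×-cancel-⊑ k total) (⊑-reflexive collect)
        where
        open ⊑-Reasoning
        a = 3 · m
        b = (2 ℕ.* ∣ S ∣) · inner S ⊕ 3 · r
        d : Fin n → W
        d v = cut ⁅ v ⁆ (S ∖ v)

        weighted : ∀ v → (χ S v · a) ⊑ (χ S v · b ⊕ ∣ S ∣ · (χ S v · d v))
        weighted v with v ∈? S
        ... | yes v∈S rewrite ∈⇒χ≡1 v∈S = begin
          1 · a                              ≈⟨ ×-homo-1 a ⟩
          a                                  ≤⟨ each v v∈S ⟩
          b ⊕ ∣ S ∣ · d v                    ≈⟨ ⊕-cong (×-homo-1 b) (×-congʳ ∣ S ∣ (×-homo-1 (d v))) ⟨
          1 · b ⊕ ∣ S ∣ · (1 · d v)          ∎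
        ... | no v∉S rewrite ∉⇒χ≡0 S v∉S =
          ⊑-reflexive (≈-sym (≈-trans (⊕-identityˡ (∣ S ∣ · 0#)) (×-zeroʳ ∣ S ∣)))

        total : (suc k · a) ⊑ (suc k · (b ⊕ 2 · inner S))
        total = subst (λ j → (j · a) ⊑ (j · (b ⊕ 2 · inner S))) ∣S∣≡1+k (begin
          ∣ S ∣ · a
            ≡⟨ cong (_· a) (sum-χ S) ⟨
          sumℕ (χ S) · a
            ≈⟨ sum-×-const (χ S) a ⟨
          sum (λ v → χ S v · a)
            ≤⟨ sum-mono weighted ⟩
          sum (λ v → χ S v · b ⊕ ∣ S ∣ · (χ S v · d v))
            ≈⟨ ∑-distrib-+ (λ v → χ S v · b) (λ v → ∣ S ∣ · (χ S v · d v)) ⟩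
          sum (λ v → χ S v · b) ⊕ sum (λ v → ∣ S ∣ · (χ S v · d v))
            ≈⟨ ⊕-cong (sum-×-const (χ S) b) (sum-× ∣ S ∣ (λ v → χ S v · d v)) ⟩
          sumℕ (χ S) · b ⊕ ∣ S ∣ · sum (λ v → χ S v · d v)
            ≈⟨ ⊕-cong (×-congˡ (sum-χ S)) (×-congʳ ∣ S ∣ (sum-cut-∖ S)) ⟩
          ∣ S ∣ · b ⊕ ∣ S ∣ · (2 · inner S)
            ≈⟨ ×-distrib-+ b (2 · inner S) ∣ S ∣ ⟨
          ∣ S ∣ · (b ⊕ 2 · inner S) ∎)

        collect : b ⊕ 2 · inner S ≈ (2 ℕ.* suc ∣ S ∣) · inner S ⊕ 3 · r
        collect = begin-equality
          (2 ℕ.* ∣ S ∣) · inner S ⊕ 3 · r ⊕ 2 · inner S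
            ≈⟨ ≈-trans (⊕-assoc _ _ _)
                 (≈-trans (⊕-congˡ (⊕-comm (3 · r) (2 · inner S))) (≈-sym (⊕-assoc _ _ _))) ⟩
          (2 ℕ.* ∣ S ∣) · inner S ⊕ 2 · inner S ⊕ 3 · r
            ≈⟨ ⊕-congʳ (×-homo-+ (inner S) (2 ℕ.* ∣ S ∣) 2) ⟨
          (2 ℕ.* ∣ S ∣ ℕ.+ 2) · inner S ⊕ 3 · r
            ≡⟨ cong (λ j → j · inner S ⊕ 3 · r) (double ∣ S ∣) ⟩
          (2 ℕ.* suc ∣ S ∣) · inner S ⊕ 3 · r ∎
          where
          double : ∀ j → 2 ℕ.* j ℕ.+ 2 ≡ 2 ℕ.* suc j
          double = solve-∀

      bound : ∀ k m S → ∣ S ∣ ≡ suc k → Bound m S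
      bound zero    m S ∣S∣≡1 with ∣S∣≡1⇒S≡⁅v⁆ S ∣S∣≡1
      ... | v , refl = bound-⁅⁆ m v
      bound (suc k) m S ∣S∣≡2+k r m⊑ = bound-average m S (suc k) ∣S∣≡2+k r λ v v∈S →
        let ∣S∣≡ = ∣S∣≡1+∣S∖v∣ v∈S
            S≡   = ⁅v⁆∪S∖v≡S v∈S
        in subst (λ j → (3 · m) ⊑ ((2 ℕ.* j) · inner S ⊕ 3 · r ⊕ j · cut ⁅ v ⁆ (S ∖ v)))
          (sym ∣S∣≡)
          (subst (λ s → (3 · m) ⊑ ((2 ℕ.* suc ∣ S ∖ v ∣) · inner s ⊕ 3 · r
                                       ⊕ suc ∣ S ∖ v ∣ · cut ⁅ v ⁆ (S ∖ v))) S≡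
            (bound-split m v (S ∖ v) (⁅v⁆∩S∖v≡∅ S v)
              (bound k m (S ∖ v) (ℕ.suc-injective (trans (sym ∣S∣≡) ∣S∣≡2+k))) r
              (subst (λ s → ∀ (t : Tree s) → m ⊑ (cost t ⊕ r)) (sym S≡) m⊑)))

      lowerBound-⊑ : ∀ k m S → ∣ S ∣ ≡ suc k → (∀ (t : Tree S) → m ⊑ cost t) →
        (3 · m) ⊑ ((2 ℕ.* suc ∣ S ∣) · inner S)
      lowerBound-⊑ k m S ∣S∣≡1+k m⊑ = ⊑-trans
        (bound k m S ∣S∣≡1+k 0# λ t → ⊑-trans (m⊑ t) (⊑-reflexive (≈-sym (⊕-identityʳ (cost t)))))
        (⊑-reflexive (≈-trans (⊕-congˡ (×-zeroʳ 3)) (⊕-identityʳ _)))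

-- Inequalities between rationals

module Rational where

  open ℚ.≤-Reasoning
  open +-*-Solver

  0<p*q : ∀ {p q} → 0ℚ ℚ.< p → 0ℚ ℚ.< q → 0ℚ ℚ.< p ℚ.* q
  0<p*q {p} {q} 0<p 0<q = ℚ.positive⁻¹ (p ℚ.* q)
    {{ℚ.pos*pos⇒pos p {{ℚ.positive 0<p}} q {{ℚ.positive 0<q}}}}

  split : ∀ ε → 0ℚ ℚ.< ε → ∃ λ δ → 0ℚ ℚ.< δ × δ ℚ.+ δ ≡ ε
  split ε 0<ε = ½ ℚ.* ε , 0<p*q (ℚ.positive⁻¹ ½) 0<ε ,
    solve 1 (λ e → con ½ :* e :+ con ½ :* e := e) refl ε

  p<p+ε : ∀ p {ε} → 0ℚ ℚ.< ε → p ℚ.< p ℚ.+ ε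
  p<p+ε p {ε} 0<ε = subst (ℚ._< p ℚ.+ ε) (ℚ.+-identityʳ p) (ℚ.+-monoʳ-< p 0<ε)

  ∣p-q∣≡∣q-p∣ : ∀ p q → ℚ.∣ p ℚ.- q ∣ ≡ ℚ.∣ q ℚ.- p ∣
  ∣p-q∣≡∣q-p∣ p q =
    trans (cong ℚ.∣_∣ (solve 2 (λ a b → a :- b := :- (b :- a)) refl p q))
          (ℚ.∣-p∣≡∣p∣ (q ℚ.- p))

  p≤q+r⇒p-q≤r : ∀ p q r → p ℚ.≤ q ℚ.+ r → p ℚ.- q ℚ.≤ r
  p≤q+r⇒p-q≤r p q r h = begin
    p ℚ.- q          ≤⟨ ℚ.+-monoˡ-≤ (ℚ.- q) h ⟩
    q ℚ.+ r ℚ.- q    ≡⟨ solve 2 (λ b e → b :+ e :- b := e) refl q r ⟩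
    r                ∎

  ∣p-q∣≤r : ∀ p q r → p ℚ.≤ q ℚ.+ r → q ℚ.≤ p ℚ.+ r → ℚ.∣ p ℚ.- q ∣ ℚ.≤ r
  ∣p-q∣≤r p q r p≤ q≤ with ℚ.∣p∣≡p∨∣p∣≡-p (p ℚ.- q)
  ... | inj₁ eq = subst (ℚ._≤ r) (sym eq) (p≤q+r⇒p-q≤r p q r p≤)
  ... | inj₂ eq = subst (ℚ._≤ r)
    (trans (solve 2 (λ a b → b :- a := :- (a :- b)) refl p q) (sym eq))
    (p≤q+r⇒p-q≤r q p r q≤)

  p≤∣p∣ : ∀ p → p ℚ.≤ ℚ.∣ p ∣
  p≤∣p∣ p with ℚ.≤-total 0ℚ p
  ... | inj₁ 0≤p = ℚ.≤-reflexive (sym (ℚ.0≤p⇒∣p∣≡p 0≤p))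
  ... | inj₂ p≤0 = ℚ.≤-trans p≤0 (ℚ.0≤∣p∣ p)

  ∣p-q∣<r⇒p≤q+r : ∀ p q r → ℚ.∣ p ℚ.- q ∣ ℚ.< r → p ℚ.≤ q ℚ.+ r
  ∣p-q∣<r⇒p≤q+r p q r h = begin
    p                  ≡⟨ solve 2 (λ a b → a := b :+ (a :- b)) refl p q ⟩
    q ℚ.+ (p ℚ.- q)    ≤⟨ ℚ.+-monoʳ-≤ q (ℚ.≤-trans (p≤∣p∣ (p ℚ.- q)) (ℚ.<⇒≤ h)) ⟩
    q ℚ.+ r            ∎

  ∣p∣≤∣q∣+r : ∀ p q r → ℚ.∣ p ℚ.- q ∣ ℚ.< r → ℚ.∣ p ∣ ℚ.≤ ℚ.∣ q ∣ ℚ.+ r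
  ∣p∣≤∣q∣+r p q r h = begin
    ℚ.∣ p ∣                        ≡⟨ cong ℚ.∣_∣ (solve 2 (λ a b → a := b :+ (a :- b)) refl p q) ⟩
    ℚ.∣ q ℚ.+ (p ℚ.- q) ∣          ≤⟨ ℚ.∣p+q∣≤∣p∣+∣q∣ q (p ℚ.- q) ⟩
    ℚ.∣ q ∣ ℚ.+ ℚ.∣ p ℚ.- q ∣      ≤⟨ ℚ.+-monoʳ-≤ ℚ.∣ q ∣ (ℚ.<⇒≤ h) ⟩
    ℚ.∣ q ∣ ℚ.+ r                  ∎

  ≤-trans-+ : ∀ p q r s t → p ℚ.≤ q ℚ.+ s → q ℚ.≤ r ℚ.+ t → p ℚ.≤ r ℚ.+ (s ℚ.+ t)
  ≤-trans-+ p q r s t p≤ q≤ = begin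
    p                  ≤⟨ p≤ ⟩
    q ℚ.+ s            ≤⟨ ℚ.+-monoˡ-≤ s q≤ ⟩
    r ℚ.+ t ℚ.+ s      ≡⟨ solve 3 (λ c a b → c :+ b :+ a := c :+ (a :+ b)) refl r s t ⟩
    r ℚ.+ (s ℚ.+ t)    ∎

  +-mono-≤-+ : ∀ p q p′ q′ s t → p ℚ.≤ q ℚ.+ s → p′ ℚ.≤ q′ ℚ.+ t →
               p ℚ.+ p′ ℚ.≤ q ℚ.+ q′ ℚ.+ (s ℚ.+ t)
  +-mono-≤-+ p q p′ q′ s t h h′ = begin
    p ℚ.+ p′                       ≤⟨ ℚ.+-mono-≤ h h′ ⟩
    q ℚ.+ s ℚ.+ (q′ ℚ.+ t)         ≡⟨ solve 4 (λ a b c d → a :+ c :+ (b :+ d) := a :+ b :+ (c :+ d))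
                                        refl q q′ s t ⟩
    q ℚ.+ q′ ℚ.+ (s ℚ.+ t)         ∎

  +-cancelʳ-≤ : ∀ p q r → p ℚ.+ r ℚ.≤ q ℚ.+ r → p ℚ.≤ q
  +-cancelʳ-≤ p q r h = begin
    p                  ≡⟨ solve 2 (λ a c → a := a :+ c :- c) refl p r ⟩
    p ℚ.+ r ℚ.- r      ≤⟨ ℚ.+-monoˡ-≤ (ℚ.- r) h ⟩
    q ℚ.+ r ℚ.- r      ≡⟨ solve 2 (λ a c → a :+ c :- c := a) refl q r ⟩
    q                  ∎

  ∣p*r-q*r∣<δ*B : ∀ p q r δ B → 0ℚ ℚ.< B → ℚ.∣ r ∣ ℚ.≤ B → ℚ.∣ p ℚ.- q ∣ ℚ.< δ →
                  ℚ.∣ p ℚ.* r ℚ.- q ℚ.* r ∣ ℚ.< δ ℚ.* B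
  ∣p*r-q*r∣<δ*B p q r δ B 0<B r≤B h = begin-strict
    ℚ.∣ p ℚ.* r ℚ.- q ℚ.* r ∣
      ≡⟨ cong ℚ.∣_∣ (solve 3 (λ a b c → a :* c :- b :* c := (a :- b) :* c) refl p q r) ⟩
    ℚ.∣ (p ℚ.- q) ℚ.* r ∣
      ≡⟨ ℚ.∣p*q∣≡∣p∣*∣q∣ (p ℚ.- q) r ⟩
    ℚ.∣ p ℚ.- q ∣ ℚ.* ℚ.∣ r ∣
      ≤⟨ ℚ.*-monoˡ-≤-nonNeg ℚ.∣ p ℚ.- q ∣ {{ℚ.∣-∣-nonNeg (p ℚ.- q)}} r≤B ⟩
    ℚ.∣ p ℚ.- q ∣ ℚ.* B
      <⟨ ℚ.*-monoˡ-<-pos B {{ℚ.positive 0<B}} h ⟩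
    δ ℚ.* B ∎

  p*r≤q*r+δ*B : ∀ p q r δ B → 0ℚ ℚ.< δ → 0ℚ ℚ.≤ r → ℚ.∣ r ∣ ℚ.≤ B → p ℚ.≤ q ℚ.+ δ →
                p ℚ.* r ℚ.≤ q ℚ.* r ℚ.+ δ ℚ.* B
  p*r≤q*r+δ*B p q r δ B 0<δ 0≤r r≤B h = begin
    p ℚ.* r                      ≤⟨ ℚ.*-monoʳ-≤-nonNeg r {{ℚ.nonNegative 0≤r}} h ⟩
    (q ℚ.+ δ) ℚ.* r              ≡⟨ ℚ.*-distribʳ-+ r q δ ⟩
    q ℚ.* r ℚ.+ δ ℚ.* r          ≤⟨ ℚ.+-monoʳ-≤ (q ℚ.* r)
                                      (ℚ.*-monoˡ-≤-nonNeg δ {{ℚ.nonNegative (ℚ.<⇒≤ 0<δ)}}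
                                        (ℚ.≤-trans (p≤∣p∣ r) r≤B)) ⟩
    q ℚ.* r ℚ.+ δ ℚ.* B          ∎

  tolerance : ∀ B ε → 0ℚ ℚ.< B → 0ℚ ℚ.< ε → ∃ λ δ → 0ℚ ℚ.< δ × δ ℚ.* B ≡ ε
  tolerance B ε 0<B 0<ε =
      ε ℚ.* B⁻¹
    , 0<p*q 0<ε (ℚ.positive⁻¹ B⁻¹ {{ℚ.1/pos⇒pos B {{ℚ.positive 0<B}}}})
    , trans (ℚ.*-assoc ε B⁻¹ B)
            (trans (cong (ε ℚ.*_) (ℚ.*-inverseˡ B {{B≢0}})) (ℚ.*-identityʳ ε))
    where
    B≢0 : ℚ.NonZero B
    B≢0 = ℚ.pos⇒nonZero B {{ℚ.positive 0<B}}
    B⁻¹ : ℚ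
    B⁻¹ = (1/ B) {{B≢0}}

  fifth : ∀ ε → 0ℚ ℚ.< ε → ∃ λ δ → 0ℚ ℚ.< δ × δ ℚ.+ (δ ℚ.+ δ ℚ.+ δ ℚ.+ δ) ≡ ε
  fifth ε 0<ε = ⅕ ℚ.* ε , 0<p*q (ℚ.positive⁻¹ ⅕) 0<ε ,
    solve 1 (λ e → con ⅕ :* e :+ (con ⅕ :* e :+ con ⅕ :* e :+ con ⅕ :* e :+ con ⅕ :* e) := e)
      refl ε
    where
    ⅕ : ℚ
    ⅕ = + 1 ℚ./ 5

  gap-clash : ∀ p q δ → 0ℚ ℚ.< δ → p ℚ.+ (δ ℚ.+ δ) ℚ.≤ q → q ℚ.≤ p ℚ.+ δ → ⊥
  gap-clash p q δ 0<δ gap below = ℚ.<-irrefl refl (begin-strict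
    p ℚ.+ δ              <⟨ p<p+ε (p ℚ.+ δ) 0<δ ⟩
    p ℚ.+ δ ℚ.+ δ        ≡⟨ ℚ.+-assoc p δ δ ⟩
    p ℚ.+ (δ ℚ.+ δ)      ≤⟨ gap ⟩
    q                    ≤⟨ below ⟩
    p ℚ.+ δ              ∎)

  gap-persists : ∀ p q p′ q′ δ → p′ ℚ.≤ p ℚ.+ δ → p ℚ.+ (δ ℚ.+ δ ℚ.+ δ) ℚ.≤ q →
                 q ℚ.≤ q′ ℚ.+ δ → p′ ℚ.+ δ ℚ.≤ q′
  gap-persists p q p′ q′ δ p′≤ gap q≤ = +-cancelʳ-≤ (p′ ℚ.+ δ) q′ δ (begin
    p′ ℚ.+ δ ℚ.+ δ                 ≤⟨ ℚ.+-monoˡ-≤ δ (ℚ.+-monoˡ-≤ δ p′≤) ⟩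
    p ℚ.+ δ ℚ.+ δ ℚ.+ δ            ≡⟨ solve 2 (λ a d → a :+ d :+ d :+ d := a :+ (d :+ d :+ d)) refl p δ ⟩
    p ℚ.+ (δ ℚ.+ δ ℚ.+ δ)          ≤⟨ gap ⟩
    q                              ≤⟨ q≤ ⟩
    q′ ℚ.+ δ                       ∎)

  gap-shrinks : ∀ p q r δ → p ℚ.+ (δ ℚ.+ δ) ℚ.≤ q → q ℚ.≤ r ℚ.+ δ → p ℚ.+ δ ℚ.≤ r
  gap-shrinks p q r δ gap q≤ = +-cancelʳ-≤ (p ℚ.+ δ) r δ (begin
    p ℚ.+ δ ℚ.+ δ        ≡⟨ ℚ.+-assoc p δ δ ⟩
    p ℚ.+ (δ ℚ.+ δ)      ≤⟨ gap ⟩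
    q                    ≤⟨ q≤ ⟩
    r ℚ.+ δ              ∎)

  +-mono-gap : ∀ p q p′ q′ ε δ → p ℚ.+ ε ℚ.≤ q → p′ ℚ.+ δ ℚ.≤ q′ →
               p ℚ.+ p′ ℚ.+ (ε ℚ.+ δ) ℚ.≤ q ℚ.+ q′
  +-mono-gap p q p′ q′ ε δ h k = begin
    p ℚ.+ p′ ℚ.+ (ε ℚ.+ δ)         ≡⟨ solve 4 (λ a b c d → a :+ b :+ (c :+ d) := a :+ c :+ (b :+ d))
                                        refl p p′ ε δ ⟩
    p ℚ.+ ε ℚ.+ (p′ ℚ.+ δ)         ≤⟨ ℚ.+-mono-≤ h k ⟩
    q ℚ.+ q′                       ∎

open Rational

-- The ordered semiring of real numbers

-- P holds from some index on; the relations on reals are built from this.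
Eventually : (ℕ → Set) → Set
Eventually P = ∃ λ N → ∀ i → N ℕ.≤ i → P i

always : {P : ℕ → Set} → (∀ i → P i) → Eventually P
always h = 0 , λ i _ → h i

eventually-map : {P Q : ℕ → Set} → (∀ i → P i → Q i) → Eventually P → Eventually Q
eventually-map f (N , h) = N , λ i N≤i → f i (h i N≤i)

eventually-zip : {P Q R : ℕ → Set} → (∀ i → P i → Q i → R i) →
                 Eventually P → Eventually Q → Eventually R
eventually-zip f (M , h) (N , k) = M ℕ.⊔ N , λ i ≤i →
  f i (h i (ℕ.m⊔n≤o⇒m≤o M N ≤i)) (k i (ℕ.m⊔n≤o⇒n≤o M N ≤i))

eventually-absurd : Eventually (λ _ → ⊥) → ⊥
eventually-absurd (N , h) = h N ℕ.≤-refl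

-- The order in positive form: x lies below y up to every tolerance. Unlike _≤_,
-- which is a negation, it can be manipulated termwise.
infix 4 _≲_
_≲_ : ℝ → ℝ → Set
x ≲ y = ∀ ε → 0ℚ ℚ.< ε → Eventually λ i → seq x i ℚ.≤ seq y i ℚ.+ ε

≲⇒≤ : ∀ x y → x ≲ y → x ≤ y
≲⇒≤ x y x≲y (ε , 0<ε , gap) = absurd (split ε 0<ε)
  where
  absurd : (∃ λ δ → 0ℚ ℚ.< δ × δ ℚ.+ δ ≡ ε) → ⊥
  absurd (δ , 0<δ , refl) = eventually-absurd
    (eventually-zip (λ i → gap-clash (seq y i) (seq x i) δ 0<δ) gap (x≲y δ 0<δ))

-- Compare x and y at one index past which both sequences vary by less than
-- δ = ε/5. If x exceeds y there by at least 3δ, then y < x with gap δ;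
-- otherwise x stays below y + 5δ.
≤⇒≲ : ∀ x y → x ≤ y → x ≲ y
≤⇒≲ x y x≤y ε 0<ε = from-fifth (fifth ε 0<ε)
  where
  Close : ℝ → ℚ → Set
  Close z δ = ∃ λ N → ∀ i j → N ℕ.≤ i → N ℕ.≤ j → ℚ.∣ seq z i ℚ.- seq z j ∣ ℚ.< δ

  Goal : Set
  Goal = Eventually λ i → seq x i ℚ.≤ seq y i ℚ.+ ε

  from-close : ∀ δ → 0ℚ ℚ.< δ → δ ℚ.+ (δ ℚ.+ δ ℚ.+ δ ℚ.+ δ) ≡ ε →
               Close x δ → Close y δ → Goal
  from-close δ 0<δ refl (M , hx) (N , hy) = compare
    (ℚ.≤-total (seq x k) (seq y k ℚ.+ (δ ℚ.+ δ ℚ.+ δ)))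
    where
    k = M ℕ.⊔ N

    near : ∀ z K → (∀ i j → K ℕ.≤ i → K ℕ.≤ j → ℚ.∣ seq z i ℚ.- seq z j ∣ ℚ.< δ) →
           ∀ i j → K ℕ.≤ i → K ℕ.≤ j → seq z i ℚ.≤ seq z j ℚ.+ δ
    near z K h i j K≤i K≤j = ∣p-q∣<r⇒p≤q+r (seq z i) (seq z j) δ (h i j K≤i K≤j)

    M≤ : ∀ {i} → k ℕ.≤ i → M ℕ.≤ i
    M≤ = ℕ.m⊔n≤o⇒m≤o M N

    N≤ : ∀ {i} → k ℕ.≤ i → N ℕ.≤ i
    N≤ = ℕ.m⊔n≤o⇒n≤o M N

    compare : (seq x k ℚ.≤ seq y k ℚ.+ (δ ℚ.+ δ ℚ.+ δ)) ⊎
              (seq y k ℚ.+ (δ ℚ.+ δ ℚ.+ δ) ℚ.≤ seq x k) → Goal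
    compare (inj₁ below) = k , λ i k≤i →
      ≤-trans-+ (seq x i) (seq x k) (seq y i) δ (δ ℚ.+ δ ℚ.+ δ ℚ.+ δ)
        (near x M hx i k (M≤ k≤i) (M≤ ℕ.≤-refl))
        (≤-trans-+ (seq x k) (seq y k) (seq y i) (δ ℚ.+ δ ℚ.+ δ) δ below
          (near y N hy k i (N≤ ℕ.≤-refl) (N≤ k≤i)))
    compare (inj₂ above) = ⊥-elim (x≤y (δ , 0<δ , k , λ i k≤i →
      gap-persists (seq y k) (seq x k) (seq y i) (seq x i) δ
        (near y N hy i k (N≤ k≤i) (N≤ ℕ.≤-refl)) above
        (near x M hx k i (M≤ ℕ.≤-refl) (M≤ k≤i))))

  from-fifth : (∃ λ δ → 0ℚ ℚ.< δ × δ ℚ.+ (δ ℚ.+ δ ℚ.+ δ ℚ.+ δ) ≡ ε) → Goal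
  from-fifth (δ , 0<δ , eq) = from-close δ 0<δ eq (cauchy x δ 0<δ) (cauchy y δ 0<δ)

≲-trans : ∀ x y z → x ≲ y → y ≲ z → x ≲ z
≲-trans x y z x≲y y≲z ε 0<ε = halve (split ε 0<ε)
  where
  halve : (∃ λ δ → 0ℚ ℚ.< δ × δ ℚ.+ δ ≡ ε) → Eventually λ i → seq x i ℚ.≤ seq z i ℚ.+ ε
  halve (δ , 0<δ , refl) = eventually-zip
    (λ i → ≤-trans-+ (seq x i) (seq y i) (seq z i) δ δ) (x≲y δ 0<δ) (y≲z δ 0<δ)

≃⇒≲ : ∀ x y → x ≃ y → x ≲ y
≃⇒≲ x y x≃y ε 0<ε =
  eventually-map (λ i → ∣p-q∣<r⇒p≤q+r (seq x i) (seq y i) ε) (x≃y ε 0<ε)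

≃-sym : ∀ x y → x ≃ y → y ≃ x
≃-sym x y x≃y ε 0<ε = eventually-map
  (λ i → subst (ℚ._< ε) (∣p-q∣≡∣q-p∣ (seq x i) (seq y i))) (x≃y ε 0<ε)

≲-antisym : ∀ x y → x ≲ y → y ≲ x → x ≃ y
≲-antisym x y x≲y y≲x ε 0<ε = halve (split ε 0<ε)
  where
  -- The bounds obtained from _≲_ are weak, hence half of ε.
  halve : (∃ λ δ → 0ℚ ℚ.< δ × δ ℚ.+ δ ≡ ε) →
          Eventually λ i → ℚ.∣ seq x i ℚ.- seq y i ∣ ℚ.< ε
  halve (δ , 0<δ , refl) = eventually-zip
    (λ i p q → ℚ.≤-<-trans (∣p-q∣≤r (seq x i) (seq y i) δ p q) (p<p+ε δ 0<δ))
    (x≲y δ 0<δ) (y≲x δ 0<δ)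

≃-trans : ∀ x y z → x ≃ y → y ≃ z → x ≃ z
≃-trans x y z x≃y y≃z = ≲-antisym x z
  (≲-trans x y z (≃⇒≲ x y x≃y) (≃⇒≲ y z y≃z))
  (≲-trans z y x (≃⇒≲ z y (≃-sym y z y≃z)) (≃⇒≲ y x (≃-sym x y x≃y)))

-- The algebraic laws of ℝ are inherited termwise from ℚ.
termwise : ∀ x y → (∀ i → seq x i ≡ seq y i) → x ≃ y
termwise x y eq ε 0<ε = always λ i → subst (ℚ._< ε)
  (sym (cong ℚ.∣_∣ (trans (cong (ℚ._- seq y i) (eq i)) (ℚ.+-inverseʳ (seq y i))))) 0<ε

termwise-≤ : ∀ x y → (∀ i → seq x i ℚ.≤ seq y i) → x ≤ y
termwise-≤ x y h = ≲⇒≤ x y λ ε 0<ε → always λ i →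
  ℚ.≤-trans (h i) (ℚ.<⇒≤ (p<p+ε (seq y i) 0<ε))

≃-isEquivalence : IsEquivalence _≃_
≃-isEquivalence = record
  { refl  = λ {x} → termwise x x λ _ → refl
  ; sym   = λ {x} {y} → ≃-sym x y
  ; trans = λ {x} {y} {z} → ≃-trans x y z
  }

≤-isPartialOrder : IsPartialOrder _≃_ _≤_
≤-isPartialOrder = record
  { isPreorder = record
    { isEquivalence = ≃-isEquivalence
    ; reflexive     = λ {x} {y} x≃y → ≲⇒≤ x y (≃⇒≲ x y x≃y)
    ; trans         = λ {x} {y} {z} x≤y y≤z →
        ≲⇒≤ x z (≲-trans x y z (≤⇒≲ x y x≤y) (≤⇒≲ y z y≤z))
    }
  ; antisym    = λ {x} {y} x≤y y≤x → ≲-antisym x y (≤⇒≲ x y x≤y) (≤⇒≲ y x y≤x)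
  }

≤-poset : Poset 0ℓ 0ℓ 0ℓ
≤-poset = record { isPartialOrder = ≤-isPartialOrder }

<-≤-trans : ∀ x y z → x < y → y ≤ z → x < z
<-≤-trans x y z (ε , 0<ε , gap) y≤z = halve (split ε 0<ε)
  where
  halve : (∃ λ δ → 0ℚ ℚ.< δ × δ ℚ.+ δ ≡ ε) → x < z
  halve (δ , 0<δ , refl) = δ , 0<δ , eventually-zip
    (λ i → gap-shrinks (seq x i) (seq y i) (seq z i) δ) gap (≤⇒≲ y z y≤z δ 0<δ)

≤-refl : ∀ x → x ≤ x
≤-refl x = termwise-≤ x x λ _ → ℚ.≤-refl

<⇒≤ : ∀ x y → x < y → x ≤ y
<⇒≤ x y x<y = ≲⇒≤ x y λ ε 0<ε → eventually-map
  (λ i h → ℚ.≤-trans (ℚ.<⇒≤ (p<p+ε (seq x i) (proj₁ (proj₂ x<y))))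
             (ℚ.≤-trans h (ℚ.<⇒≤ (p<p+ε (seq y i) 0<ε))))
  (proj₂ (proj₂ x<y))

+-mono-< : ∀ x y x′ y′ → x < y → x′ < y′ → x + x′ < y + y′
+-mono-< x y x′ y′ (ε , 0<ε , h) (δ , 0<δ , k) = ε ℚ.+ δ , ℚ.+-mono-< 0<ε 0<δ ,
  eventually-zip (λ i → +-mono-gap (seq x i) (seq y i) (seq x′ i) (seq y′ i) ε δ) h k

+-mono-≲ : ∀ x y x′ y′ → x ≲ y → x′ ≲ y′ → x + x′ ≲ y + y′
+-mono-≲ x y x′ y′ f g ε 0<ε = halve (split ε 0<ε)
  where
  halve : (∃ λ δ → 0ℚ ℚ.< δ × δ ℚ.+ δ ≡ ε) →
          Eventually λ i → seq x i ℚ.+ seq x′ i ℚ.≤ seq y i ℚ.+ seq y′ i ℚ.+ ε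
  halve (δ , 0<δ , refl) = eventually-zip
    (λ i → +-mono-≤-+ (seq x i) (seq y i) (seq x′ i) (seq y′ i) δ δ) (f δ 0<δ) (g δ 0<δ)

+-mono-≤ : ∀ x y x′ y′ → x ≤ y → x′ ≤ y′ → x + x′ ≤ y + y′
+-mono-≤ x y x′ y′ f g =
  ≲⇒≤ (x + x′) (y + y′) (+-mono-≲ x y x′ y′ (≤⇒≲ x y f) (≤⇒≲ x′ y′ g))

+-cong : ∀ x y x′ y′ → x ≃ y → x′ ≃ y′ → x + x′ ≃ y + y′
+-cong x y x′ y′ f g = ≲-antisym (x + x′) (y + y′)
  (+-mono-≲ x y x′ y′ (≃⇒≲ x y f) (≃⇒≲ x′ y′ g))
  (+-mono-≲ y x y′ x′ (≃⇒≲ y x (≃-sym x y f)) (≃⇒≲ y′ x′ (≃-sym x′ y′ g)))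

eventuallyBounded : ∀ x → ∃ λ B → 0ℚ ℚ.< B × Eventually λ i → ℚ.∣ seq x i ∣ ℚ.≤ B
eventuallyBounded x = bound (cauchy x 1ℚ (ℚ.positive⁻¹ 1ℚ))
  where
  bound : (∃ λ N → ∀ i j → N ℕ.≤ i → N ℕ.≤ j → ℚ.∣ seq x i ℚ.- seq x j ∣ ℚ.< 1ℚ) →
          ∃ λ B → 0ℚ ℚ.< B × Eventually λ i → ℚ.∣ seq x i ∣ ℚ.≤ B
  bound (N , h) = ℚ.∣ seq x N ∣ ℚ.+ 1ℚ
                , ℚ.+-mono-≤-< (ℚ.0≤∣p∣ (seq x N)) (ℚ.positive⁻¹ 1ℚ)
                , N , λ i N≤i → ∣p∣≤∣q∣+r (seq x i) (seq x N) 1ℚ (h i N N≤i ℕ.≤-refl)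

*-congʳ : ∀ x y z → x ≃ y → x * z ≃ y * z
*-congʳ x y z x≃y ε 0<ε = bounded (eventuallyBounded z)
  where
  Goal : Set
  Goal = Eventually λ i → ℚ.∣ seq x i ℚ.* seq z i ℚ.- seq y i ℚ.* seq z i ∣ ℚ.< ε

  bounded : (∃ λ B → 0ℚ ℚ.< B × Eventually λ i → ℚ.∣ seq z i ∣ ℚ.≤ B) → Goal
  bounded (B , 0<B , ∣z∣≤B) = with-tolerance (tolerance B ε 0<B 0<ε)
    where
    with-tolerance : (∃ λ δ → 0ℚ ℚ.< δ × δ ℚ.* B ≡ ε) → Goal
    with-tolerance (δ , 0<δ , refl) = eventually-zip
      (λ i → ∣p*r-q*r∣<δ*B (seq x i) (seq y i) (seq z i) δ B 0<B) ∣z∣≤B (x≃y δ 0<δ)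

*-comm : ∀ x y → x * y ≃ y * x
*-comm x y = termwise (x * y) (y * x) λ i → ℚ.*-comm (seq x i) (seq y i)

*-cong : ∀ x y x′ y′ → x ≃ y → x′ ≃ y′ → x * x′ ≃ y * y′
*-cong x y x′ y′ x≃y x′≃y′ =
  ≃-trans (x * x′) (y * x′) (y * y′) (*-congʳ x y x′ x≃y)
    (≃-trans (y * x′) (x′ * y) (y * y′) (*-comm y x′)
      (≃-trans (x′ * y) (y′ * y) (y * y′) (*-congʳ x′ y′ y x′≃y′) (*-comm y′ y)))

-- A sufficient condition for z ≥ 0, on the sequence representing z.
Nonneg : ℝ → Set
Nonneg z = Eventually λ i → 0ℚ ℚ.≤ seq z i

*-monoʳ-≤ : ∀ x y z → Nonneg z → x ≤ y → x * z ≤ y * z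
*-monoʳ-≤ x y z 0≤z x≤y = ≲⇒≤ (x * z) (y * z) λ ε 0<ε → bounded ε 0<ε (eventuallyBounded z)
  where
  Goal : ℚ → Set
  Goal ε = Eventually λ i → seq x i ℚ.* seq z i ℚ.≤ seq y i ℚ.* seq z i ℚ.+ ε

  bounded : ∀ ε → 0ℚ ℚ.< ε →
            (∃ λ B → 0ℚ ℚ.< B × Eventually λ i → ℚ.∣ seq z i ∣ ℚ.≤ B) → Goal ε
  bounded ε 0<ε (B , 0<B , ∣z∣≤B) = with-tolerance (tolerance B ε 0<B 0<ε)
    where
    with-tolerance : (∃ λ δ → 0ℚ ℚ.< δ × δ ℚ.* B ≡ ε) → Goal ε
    with-tolerance (δ , 0<δ , refl) = eventually-zip
      (λ i (0≤zᵢ , ∣zᵢ∣≤B) → p*r≤q*r+δ*B (seq x i) (seq y i) (seq z i) δ B 0<δ 0≤zᵢ ∣zᵢ∣≤B)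
      (eventually-zip (λ _ → _,_) 0≤z ∣z∣≤B) (≤⇒≲ x y x≤y δ 0<δ)

ℝ-semiring : CommutativeSemiring 0ℓ 0ℓ
ℝ-semiring = record
  { Carrier = ℝ ; _≈_ = _≃_ ; _+_ = _+_ ; _*_ = _*_ ; 0# = 0ℝ ; 1# = 1ℝ
  ; isCommutativeSemiring = isCommutativeSemiringˡ record
    { +-isCommutativeMonoid = record
      { isMonoid = record
        { isSemigroup = record
          { isMagma = record
            { isEquivalence = ≃-isEquivalence
            ; ∙-cong = λ {x} {y} {u} {v} → +-cong x y u v }
          ; assoc = λ x y z → termwise (x + y + z) (x + (y + z)) λ i →
              ℚ.+-assoc (seq x i) (seq y i) (seq z i) }
        ; identity = (λ x → termwise (0ℝ + x) x λ i → ℚ.+-identityˡ (seq x i))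
                   , (λ x → termwise (x + 0ℝ) x λ i → ℚ.+-identityʳ (seq x i)) }
      ; comm = λ x y → termwise (x + y) (y + x) λ i → ℚ.+-comm (seq x i) (seq y i) }
    ; *-isCommutativeMonoid = record
      { isMonoid = record
        { isSemigroup = record
          { isMagma = record
            { isEquivalence = ≃-isEquivalence
            ; ∙-cong = λ {x} {y} {u} {v} → *-cong x y u v }
          ; assoc = λ x y z → termwise (x * y * z) (x * (y * z)) λ i →
              ℚ.*-assoc (seq x i) (seq y i) (seq z i) }
        ; identity = (λ x → termwise (1ℝ * x) x λ i → ℚ.*-identityˡ (seq x i))
                   , (λ x → termwise (x * 1ℝ) x λ i → ℚ.*-identityʳ (seq x i)) }
      ; comm = *-comm }
    ; distribʳ = λ x y z → termwise ((y + z) * x) (y * x + z * x) λ i →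
        ℚ.*-distribʳ-+ (seq x i) (seq y i) (seq z i)
    ; zeroˡ = λ x → termwise (0ℝ * x) 0ℝ λ i → ℚ.*-zeroˡ (seq x i)
    }
  }

ℝ-monoid : CommutativeMonoid 0ℓ 0ℓ
ℝ-monoid = CommutativeSemiring.+-commutativeMonoid ℝ-semiring

open CommutativeSemiring ℝ-semiring using (*-identityˡ; *-identityʳ; *-assoc; semiring)
  renaming (refl to ≃-refl)
open IsPartialOrder ≤-isPartialOrder using ()
  renaming (reflexive to ≃⇒≤; trans to ≤-trans; antisym to ≤-antisym)
open import Algebra.Properties.Semiring.Mult semiring
  using (×-congʳ; ×-homo-+; ×-assocˡ; ×-comm-*; ×-assoc-*) renaming (_×_ to _·_)
open import Algebra.Properties.CommutativeMonoid.Sum ℝ-monoid using (sum)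

module ℝ-Reasoning = PosetReasoning ≤-poset

·-mono-< : ∀ k x y → x < y → suc k · x < suc k · y
·-mono-< zero    x y x<y = +-mono-≤-< x<y
  where
  +-mono-≤-< : x < y → x + 0ℝ < y + 0ℝ
  +-mono-≤-< (ε , 0<ε , h) = ε , 0<ε , eventually-map (λ i → ≡.subst₂ (λ a b → a ℚ.+ ε ℚ.≤ b)
    (sym (ℚ.+-identityʳ (seq x i))) (sym (ℚ.+-identityʳ (seq y i)))) h
·-mono-< (suc k) x y x<y = +-mono-< x y (suc k · x) (suc k · y) x<y (·-mono-< k x y x<y)

·-mono-≤ : ∀ k x y → x ≤ y → k · x ≤ k · y
·-mono-≤ zero    x y x≤y = ≤-refl 0ℝ
·-mono-≤ (suc k) x y x≤y = +-mono-≤ x y (k · x) (k · y) x≤y (·-mono-≤ k x y x≤y)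

-- Immediate, since x ≤ y denies y < x.
·-cancel-≤ : ∀ k x y → suc k · x ≤ suc k · y → x ≤ y
·-cancel-≤ k x y h y<x = h (·-mono-< k y x y<x)

fromℕ-mono : ∀ {a b} → a ℕ.≤ b → ∀ i → seq (fromℕ a) i ℚ.≤ seq (fromℕ b) i
fromℕ-mono {b = zero}  z≤n       i = ℚ.≤-refl
fromℕ-mono {b = suc b} z≤n       i =
  ℚ.≤-trans (fromℕ-mono {b = b} z≤n i) (ℚ.≤-trans (ℚ.<⇒≤ (p<p+ε _ (ℚ.positive⁻¹ 1ℚ)))
    (ℚ.≤-reflexive (ℚ.+-comm (seq (fromℕ b) i) 1ℚ)))
fromℕ-mono             (s≤s a≤b) i = ℚ.+-monoʳ-≤ 1ℚ (fromℕ-mono a≤b i)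

fromℕ-mono-≤ : ∀ {a b} → a ℕ.≤ b → fromℕ a ≤ fromℕ b
fromℕ-mono-≤ {a} {b} a≤b = termwise-≤ (fromℕ a) (fromℕ b) (fromℕ-mono a≤b)

0<fromℕ-suc : ∀ k → 0ℝ < fromℕ (suc k)
0<fromℕ-suc k = 1ℚ , ℚ.positive⁻¹ 1ℚ , always λ i →
  ℚ.≤-trans (ℚ.≤-reflexive (ℚ.+-comm 0ℚ 1ℚ)) (ℚ.+-monoʳ-≤ 1ℚ (fromℕ-mono {b = k} z≤n i))

1≃fromℕ1 : 1ℝ ≃ fromℕ 1
1≃fromℕ1 = termwise 1ℝ (fromℕ 1) λ _ → refl

⊔-lub : ∀ x y z → x ≤ z → y ≤ z → x ⊔ y ≤ z
⊔-lub x y z x≤z y≤z = ≲⇒≤ (x ⊔ y) z λ ε 0<ε →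
  eventually-zip (λ i → ℚ.⊔-lub) (≤⇒≲ x z x≤z ε 0<ε) (≤⇒≲ y z y≤z ε 0<ε)

0<⇒Nonneg : ∀ x → 0ℝ < x → Nonneg x
0<⇒Nonneg x (ε , 0<ε , h) = eventually-map
  (λ i → ℚ.≤-trans (ℚ.≤-trans (ℚ.<⇒≤ 0<ε) (ℚ.≤-reflexive (sym (ℚ.+-identityˡ ε))))) h

-- Division

recip-inverse : ∀ q → 0ℚ ℚ.< q → q ℚ.* recip q ≡ 1ℚ
recip-inverse q 0<q with q ℚ.≟ 0ℚ
... | yes q≡0 = ⊥-elim (ℚ.<-irrefl (sym q≡0) 0<q)
... | no  q≢0 = ℚ.*-inverseʳ q {{ℚ.≢-nonZero q≢0}}

recip-nonneg : ∀ q → 0ℚ ℚ.< q → 0ℚ ℚ.≤ recip q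
recip-nonneg q 0<q with q ℚ.≟ 0ℚ
... | yes _   = ℚ.≤-refl
... | no  q≢0 = ℚ.<⇒≤ (ℚ.positive⁻¹ ((1/ q) {{ℚ.≢-nonZero q≢0}})
                         {{ℚ.1/pos⇒pos q {{ℚ.positive 0<q}}}})

module _ (y : ℝ) (0<y : 0ℝ < y) where

  eventually-positive : Eventually λ i → 0ℚ ℚ.< seq y i
  eventually-positive = eventually-map
    (λ i → ℚ.<-≤-trans (p<p+ε 0ℚ (proj₁ (proj₂ 0<y)))) (proj₂ (proj₂ 0<y))

  ⁻¹-Nonneg : Nonneg (y ⁻¹[ 0<y ])
  ⁻¹-Nonneg = eventually-map (λ i → recip-nonneg (seq y i)) eventually-positive

  ⁻¹-inverse : y * y ⁻¹[ 0<y ] ≃ 1ℝ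
  ⁻¹-inverse ε 0<ε = eventually-map (λ i 0<yᵢ → subst (ℚ._< ε)
    (sym (cong (λ q → ℚ.∣ q ℚ.- 1ℚ ∣) (recip-inverse (seq y i) 0<yᵢ))) 0<ε)
    eventually-positive

  *-cancel-⁻¹ : ∀ c → c * y * y ⁻¹[ 0<y ] ≃ c
  *-cancel-⁻¹ c = begin-equality
    c * y * y ⁻¹[ 0<y ]      ≈⟨ *-assoc c y (y ⁻¹[ 0<y ]) ⟩
    c * (y * y ⁻¹[ 0<y ])    ≈⟨ *-cong c c (y * y ⁻¹[ 0<y ]) 1ℝ (≃-refl {c}) ⁻¹-inverse ⟩
    c * 1ℝ                   ≈⟨ *-identityʳ c ⟩
    c                        ∎
    where open ℝ-Reasoning

  ÷-≤ : ∀ x c → x ≤ c * y → x ÷ y [ 0<y ] ≤ c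
  ÷-≤ x c h = begin
    x * y ⁻¹[ 0<y ]          ≤⟨ *-monoʳ-≤ x (c * y) (y ⁻¹[ 0<y ]) ⁻¹-Nonneg h ⟩
    c * y * y ⁻¹[ 0<y ]      ≈⟨ *-cancel-⁻¹ c ⟩
    c                        ∎
    where open ℝ-Reasoning

  ÷-≃ : ∀ x c → x ≃ c * y → x ÷ y [ 0<y ] ≃ c
  ÷-≃ x c h = begin-equality
    x * y ⁻¹[ 0<y ]          ≈⟨ *-congʳ x (c * y) (y ⁻¹[ 0<y ]) h ⟩
    c * y * y ⁻¹[ 0<y ]      ≈⟨ *-cancel-⁻¹ c ⟩
    c                        ∎
    where open ℝ-Reasoning

⅓ : ℝ
⅓ = fromℚ (+ 1 ℚ./ 3)

⅓-nonneg : Nonneg ⅓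
⅓-nonneg = always λ _ → ℚ.<⇒≤ (ℚ.positive⁻¹ (+ 1 ℚ./ 3))

3·x*⅓≃x : ∀ x → (3 · x) * ⅓ ≃ x
3·x*⅓≃x x = begin-equality
  (3 · x) * ⅓     ≈⟨ ×-assoc-* 3 x ⅓ ⟩
  3 · (x * ⅓)     ≈⟨ ×-comm-* 3 x ⅓ ⟨
  x * (3 · ⅓)     ≈⟨ *-cong x x (3 · ⅓) 1ℝ (≃-refl {x}) (termwise (3 · ⅓) 1ℝ λ _ → refl) ⟩
  x * 1ℝ          ≈⟨ *-identityʳ x ⟩
  x               ∎
  where open ℝ-Reasoning

k·y*⅓≃ : ∀ k y → (k · y) * ⅓ ≃ fromℕ k * ⅓ * y
k·y*⅓≃ k y = begin-equality
  (k · y) * ⅓           ≈⟨ ×-assoc-* k y ⅓ ⟩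
  k · (y * ⅓)           ≈⟨ ×-congʳ k {y * ⅓} {1ℝ * (⅓ * y)} (begin-equality
    y * ⅓                    ≈⟨ *-comm y ⅓ ⟩
    ⅓ * y                    ≈⟨ *-identityˡ (⅓ * y) ⟨
    1ℝ * (⅓ * y)             ∎) ⟩
  k · (1ℝ * (⅓ * y))    ≈⟨ ×-assoc-* k 1ℝ (⅓ * y) ⟨
  fromℕ k * (⅓ * y)     ≈⟨ *-assoc (fromℕ k) ⅓ y ⟨
  fromℕ k * ⅓ * y       ∎
  where open ℝ-Reasoning

≤-factor : ∀ n x y → 3 · x ≤ (2 ℕ.* suc n) · y → x ≤ factor n * y
≤-factor n x y h = begin
  x                               ≈⟨ 3·x*⅓≃x x ⟨
  (3 · x) * ⅓                     ≤⟨ *-monoʳ-≤ (3 · x) ((2 ℕ.* suc n) · y) ⅓ ⅓-nonneg h ⟩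
  ((2 ℕ.* suc n) · y) * ⅓         ≈⟨ k·y*⅓≃ (2 ℕ.* suc n) y ⟩
  fromℕ (2 ℕ.* suc n) * ⅓ * y     ≡⟨ cong (λ k → fromℕ (2 ℕ.* k) * ⅓ * y) (ℕ.+-comm 1 n) ⟩
  factor n * y                    ∎
  where open ℝ-Reasoning

≃-factor : ∀ n x y → 3 · x ≃ (2 ℕ.* suc n) · y → x ≃ factor n * y
≃-factor n x y h = begin-equality
  x                               ≈⟨ 3·x*⅓≃x x ⟨
  (3 · x) * ⅓                     ≈⟨ *-congʳ (3 · x) ((2 ℕ.* suc n) · y) ⅓ h ⟩
  ((2 ℕ.* suc n) · y) * ⅓         ≈⟨ k·y*⅓≃ (2 ℕ.* suc n) y ⟩
  fromℕ (2 ℕ.* suc n) * ⅓ * y     ≡⟨ cong (λ k → fromℕ (2 ℕ.* k) * ⅓ * y) (ℕ.+-comm 1 n) ⟩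
  factor n * y                    ∎
  where open ℝ-Reasoning

-- Sums over edges

sum-nonneg : ∀ {m} (f : Fin m → ℝ) → (∀ i → 0ℝ ≤ f i) → 0ℝ ≤ sum f
sum-nonneg {zero}  f 0≤f = ≤-refl 0ℝ
sum-nonneg {suc m} f 0≤f = begin
  0ℝ           ≈⟨ termwise 0ℝ (0ℝ + 0ℝ) (λ _ → refl) ⟩
  0ℝ + 0ℝ      ≤⟨ +-mono-≤ 0ℝ (f Fin.zero) 0ℝ (sum λ i → f (Fin.suc i))
                    (0≤f Fin.zero) (sum-nonneg (λ i → f (Fin.suc i)) λ i → 0≤f (Fin.suc i)) ⟩
  sum f        ∎
  where open ℝ-Reasoning

term≤sum : ∀ {m} (f : Fin m → ℝ) → (∀ i → 0ℝ ≤ f i) → ∀ i → f i ≤ sum f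
term≤sum {suc m} f 0≤f Fin.zero = begin
  f Fin.zero          ≈⟨ termwise (f Fin.zero) (f Fin.zero + 0ℝ) (λ i → sym (ℚ.+-identityʳ _)) ⟩
  f Fin.zero + 0ℝ     ≤⟨ +-mono-≤ (f Fin.zero) (f Fin.zero) 0ℝ (sum λ i → f (Fin.suc i))
                           (≤-refl (f Fin.zero)) (sum-nonneg (λ i → f (Fin.suc i)) λ i → 0≤f (Fin.suc i)) ⟩
  sum f               ∎
  where open ℝ-Reasoning
term≤sum {suc m} f 0≤f (Fin.suc i) = begin
  f (Fin.suc i)       ≈⟨ termwise (f (Fin.suc i)) (0ℝ + f (Fin.suc i)) (λ i → sym (ℚ.+-identityˡ _)) ⟩
  0ℝ + f (Fin.suc i)  ≤⟨ +-mono-≤ 0ℝ (f Fin.zero) (f (Fin.suc i)) (sum λ i → f (Fin.suc i))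
                           (0≤f Fin.zero) (term≤sum (λ i → f (Fin.suc i)) (λ i → 0≤f (Fin.suc i)) i) ⟩
  sum f               ∎
  where open ℝ-Reasoning

private
  module Orderedℝ = Averaging.OrderedWeights ℝ-monoid _≤_ ≤-isPartialOrder
    (λ {x} {y} {x′} {y′} → +-mono-≤ x y x′ y′) (λ k {x} {y} → ·-cancel-≤ k x y)

sum-mono-≤ : ∀ {m} (f g : Fin m → ℝ) → (∀ i → f i ≤ g i) → sum f ≤ sum g
sum-mono-≤ f g = Orderedℝ.sum-mono {f = f} {g}

sum-cong-≃ : ∀ {m} (f g : Fin m → ℝ) → (∀ i → f i ≃ g i) → sum f ≃ sum g
sum-cong-≃ f g = Pairing.sum-cong ℝ-monoid {f = f} {g}

module EdgeSums (G : WeightedGraph n) where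

  open WeightedGraph G

  edgeTerm-mono : ∀ f g x y → (x ~ y → f x y ≤ g x y) → ∀ d e →
                  edgeTerm G f x y d e ≤ edgeTerm G g x y d e
  edgeTerm-mono f g x y f≤g (yes _) (yes e) = begin
    weight x y e * f x y      ≈⟨ *-comm (weight x y e) (f x y) ⟩
    f x y * weight x y e      ≤⟨ *-monoʳ-≤ (f x y) (g x y) (weight x y e)
                                   (0<⇒Nonneg (weight x y e) (weight-pos x y e)) (f≤g e) ⟩
    g x y * weight x y e      ≈⟨ *-comm (g x y) (weight x y e) ⟩
    weight x y e * g x y      ∎
    where open ℝ-Reasoning
  edgeTerm-mono f g x y f≤g (yes _) (no _) = ≤-refl 0ℝ
  edgeTerm-mono f g x y f≤g (no _)  _      = ≤-refl 0ℝ

  edgeSum-mono : ∀ f g → (∀ x y → x ~ y → f x y ≤ g x y) → edgeSum G f ≤ edgeSum G g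
  edgeSum-mono f g f≤g = sum-mono-≤ _ _ λ x → sum-mono-≤ _ _ λ y →
    edgeTerm-mono f g x y (f≤g x y) (x Fin.<? y) (T? (adjacent x y))

  edgeSum-cong : ∀ f g → (∀ x y → x ~ y → f x y ≃ g x y) → edgeSum G f ≃ edgeSum G g
  edgeSum-cong f g f≃g = ≤-antisym {edgeSum G f} {edgeSum G g}
    (edgeSum-mono f g λ x y e → ≃⇒≤ {f x y} {g x y} (f≃g x y e))
    (edgeSum-mono g f λ x y e → ≃⇒≤ {g x y} {f x y} (≃-sym (f x y) (g x y) (f≃g x y e)))

  -- The function whose edge sum is the total weight.
  one : Fin n → Fin n → ℝ
  one _ _ = 1ℝ

  -- The weight of the ordered pair (x, y): each edge is counted once, with
  -- x < y, and all other pairs have weight 0.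
  ω : Fin n → Fin n → ℝ
  ω x y = edgeTerm G one x y (x Fin.<? y) (T? (adjacent x y))

  totalWeight : ℝ
  totalWeight = edgeSum G one

  edgeTerm-fromℕ : ∀ k f x y d e → f x y ≃ fromℕ k →
                   edgeTerm G f x y d e ≃ k · edgeTerm G one x y d e
  edgeTerm-fromℕ k f x y (yes _) (yes e) f≃k = begin-equality
    weight x y e * f x y            ≈⟨ *-cong (weight x y e) (weight x y e) (f x y) (fromℕ k)
                                         (≃-refl {weight x y e}) f≃k ⟩
    weight x y e * (k · 1ℝ)         ≈⟨ ×-comm-* k (weight x y e) 1ℝ ⟩
    k · (weight x y e * 1ℝ)         ∎
    where open ℝ-Reasoning
  edgeTerm-fromℕ k f x y (yes _) (no _) _ = ≃-sym (k · 0ℝ) 0ℝ (Pairing.×-zeroʳ ℝ-monoid k)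
  edgeTerm-fromℕ k f x y (no _)  _      _ = ≃-sym (k · 0ℝ) 0ℝ (Pairing.×-zeroʳ ℝ-monoid k)

  open Pairing ℝ-monoid

  edgeSum≃⟨∣⟩ : ∀ f (c : Fin n → Fin n → ℕ) → (∀ x y → f x y ≃ fromℕ (c x y)) →
                edgeSum G f ≃ ⟨ ω ∣ c ⟩
  edgeSum≃⟨∣⟩ f c f≃c = sum-cong-≃ _ _ λ x → sum-cong-≃ _ _ λ y →
    edgeTerm-fromℕ (c x y) f x y (x Fin.<? y) (T? (adjacent x y)) (f≃c x y)

  ω-diagonal : ∀ x → ω x x ≃ 0ℝ
  ω-diagonal x with x Fin.<? x
  ... | yes x<x = ⊥-elim (Fin.<-irrefl refl x<x)
  ... | no _    = ≃-refl {0ℝ}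

  open Offdiagonal ω ω-diagonal public using (cost; inner)

  χ-⊤ : ∀ (x : Fin n) → χ ⊤ x ≡ 1
  χ-⊤ x = ∈⇒χ≡1 (∈⊤ {x = x})

  dasguptaCost≃cost : ∀ t → dasguptaCost G t ≃ cost t
  dasguptaCost≃cost t = edgeSum≃⟨∣⟩ (λ x y → fromℕ ∣ lcaCluster t x y ∣) (lcaSize t) λ x y →
    termwise (fromℕ ∣ lcaCluster t x y ∣) (fromℕ (lcaSize t x y)) λ i →
      cong (λ k → seq (fromℕ k) i) (sym (lcaSize≡ x y))
    where
    lcaSize≡ : ∀ x y → lcaSize t x y ≡ ∣ lcaCluster t x y ∣
    lcaSize≡ x y rewrite χ-⊤ x | χ-⊤ y = ℕ.+-identityʳ _

  totalWeight≃inner : totalWeight ≃ inner ⊤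
  totalWeight≃inner = edgeSum≃⟨∣⟩ one (within ⊤) λ x y →
    termwise 1ℝ (fromℕ (within ⊤ x y)) λ i → cong (λ k → seq (fromℕ k) i) (sym (within≡1 x y))
    where
    within≡1 : ∀ x y → within ⊤ x y ≡ 1
    within≡1 x y rewrite χ-⊤ x | χ-⊤ y = refl

  open Orderedℝ.Caterpillars ω ω-diagonal using (lowerBound-⊑)

  OPT-D≤ : 1 ℕ.≤ n → ∀ D → (∀ t → D ≤ dasguptaCost G t) → 3 · D ≤ (2 ℕ.* suc n) · totalWeight
  OPT-D≤ 1≤n D D≤ = begin
    3 · D
      ≤⟨ lowerBound-⊑ (ℕ.pred n) D ⊤ ∣⊤∣≡ (λ t →
           ≤-trans {D} {dasguptaCost G t} {cost t} (D≤ t)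
             (≃⇒≤ {dasguptaCost G t} {cost t} (dasguptaCost≃cost t))) ⟩
    (2 ℕ.* suc ∣ ⊤ {n} ∣) · inner ⊤
      ≡⟨ cong (λ k → (2 ℕ.* suc k) · inner ⊤) (∣⊤∣≡n n) ⟩
    (2 ℕ.* suc n) · inner ⊤
      ≈⟨ ×-congʳ (2 ℕ.* suc n) {totalWeight} {inner ⊤} totalWeight≃inner ⟨
    (2 ℕ.* suc n) · totalWeight ∎
    where
    open ℝ-Reasoning
    ∣⊤∣≡ : ∣ ⊤ {n} ∣ ≡ suc (ℕ.pred n)
    ∣⊤∣≡ = trans (∣⊤∣≡n n) (sym (ℕ.suc-pred n {{ℕ.>-nonZero 1≤n}}))

  -- The endpoints of an edge have distance 1, so dominating ultrametrics are at
  -- least 1 on edges.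
  edge-distance : ∀ {x y} → x ~ y → IsDistance G x y 1
  edge-distance {x} e = (e ∷ []) , λ { zero [] → ⊥-elim (loop e) ; (suc j) _ → s≤s z≤n }
    where
    loop : x ~ x → _
    loop e = subst T (adj-irrefl x) e

  totalWeight≤ : ∀ (U : DominatingUltrametric G) →
                 totalWeight ≤ edgeSum G (DominatingUltrametric.u U)
  totalWeight≤ U = edgeSum-mono one u λ x y e →
    ≤-trans {1ℝ} {fromℕ 1} {u x y} (≃⇒≤ {1ℝ} {fromℕ 1} 1≃fromℕ1) (dominates x y 1 (edge-distance e))
    where open DominatingUltrametric U

  0≤ω : ∀ x y → 0ℝ ≤ ω x y
  0≤ω x y with x Fin.<? y | T? (adjacent x y)
  ... | yes _ | yes e = begin
    0ℝ                       ≤⟨ <⇒≤ 0ℝ (weight x y e) (weight-pos x y e) ⟩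
    weight x y e             ≈⟨ *-identityʳ (weight x y e) ⟨
    weight x y e * 1ℝ        ∎
    where open ℝ-Reasoning
  ... | yes _ | no _  = ≤-refl 0ℝ
  ... | no _  | _     = ≤-refl 0ℝ

  0<ω : ∀ x y → x Fin.< y → x ~ y → 0ℝ < ω x y
  0<ω x y x<y x~y with x Fin.<? y | T? (adjacent x y)
  ... | yes _ | yes e = <-≤-trans 0ℝ (weight x y e) (weight x y e * 1ℝ) (weight-pos x y e)
    (≃⇒≤ {weight x y e} {weight x y e * 1ℝ}
      (≃-sym (weight x y e * 1ℝ) (weight x y e) (*-identityʳ (weight x y e))))
  ... | yes _ | no ¬e = ⊥-elim (¬e x~y)
  ... | no ¬< | _     = ⊥-elim (¬< x<y)

  0<totalWeight-edge : ∀ x y → x Fin.< y → x ~ y → 0ℝ < totalWeight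
  0<totalWeight-edge x y x<y x~y = <-≤-trans 0ℝ (ω x y) totalWeight (0<ω x y x<y x~y) (begin
    ω x y              ≤⟨ term≤sum (ω x) (0≤ω x) y ⟩
    sum (ω x)          ≤⟨ term≤sum (λ x → sum (ω x)) (λ x → sum-nonneg (ω x) (0≤ω x)) x ⟩
    totalWeight        ∎)
    where open ℝ-Reasoning

  0<totalWeight : 2 ℕ.≤ n → Connected G → 0ℝ < totalWeight
  0<totalWeight (s≤s (s≤s _)) connected = from-walk (proj₂ (connected Fin.zero (Fin.suc Fin.zero)))
    where
    from-walk : ∀ {k} → Walk G Fin.zero (Fin.suc Fin.zero) k → 0ℝ < totalWeight
    from-walk (_∷_ {y = Fin.zero}  e _) = ⊥-elim (subst T (adj-irrefl Fin.zero) e)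
    from-walk (_∷_ {y = Fin.suc y} e _) = 0<totalWeight-edge Fin.zero (Fin.suc y) (s≤s z≤n) e

  ratio≤factor : 2 ℕ.≤ n → Connected G → ∀ D F → IsOPT-D G D → IsOPT-free G F →
                 Σ (0ℝ < F) λ 0<F → D ÷ F [ 0<F ] ≤ factor n
  ratio≤factor 2≤n connected D F (_ , D≤) ((U , U≃F) , _) = 0<F , ÷-≤ F 0<F D (factor n)
    (≤-factor n D F (begin
      3 · D                          ≤⟨ OPT-D≤ (ℕ.≤-trans (s≤s z≤n) 2≤n) D D≤ ⟩
      (2 ℕ.* suc n) · totalWeight    ≤⟨ ·-mono-≤ (2 ℕ.* suc n) totalWeight F W≤F ⟩
      (2 ℕ.* suc n) · F              ∎))
    where
    open ℝ-Reasoning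
    W≤F : totalWeight ≤ F
    W≤F = ≤-trans {totalWeight} {edgeSum G (DominatingUltrametric.u U)} {F} (totalWeight≤ U)
      (≃⇒≤ {edgeSum G (DominatingUltrametric.u U)} {F} U≃F)
    0<F : 0ℝ < F
    0<F = <-≤-trans 0ℝ totalWeight F (0<totalWeight 2≤n connected) W≤F

-- Trees on a given set

tree-on : ∀ k (S : Subset n) → ∣ S ∣ ≡ suc k → Tree S
tree-on zero    S ∣S∣≡1 = subst Tree (proj₂ v,eq) (leaf (proj₁ v,eq))
  where v,eq = ∣S∣≡1⇒S≡⁅v⁆ S ∣S∣≡1
tree-on (suc k) S ∣S∣≡2+k = split-off (∣S∣≡1+k⇒Nonempty S ∣S∣≡2+k)
  where
  split-off : Nonempty S → Tree S
  split-off (v , v∈S) = subst Tree (⁅v⁆∪S∖v≡S v∈S) (node (⁅v⁆∩S∖v≡∅ S v) (leaf v)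
    (tree-on k (S ∖ v) (ℕ.suc-injective (trans (sym (∣S∣≡1+∣S∖v∣ v∈S)) ∣S∣≡2+k))))

hierarchy : 1 ℕ.≤ n → Hierarchy n
hierarchy {n} 1≤n = tree-on (ℕ.pred n) ⊤
  (trans (∣⊤∣≡n n) (sym (ℕ.suc-pred n {{ℕ.>-nonZero 1≤n}})))

-- Complete graphs

module Complete {n : ℕ} where

  open Pairing ℕ.+-0-commutativeMonoid
  open import Algebra.Properties.Semiring.Sum ℕ.+-*-semiring using (*-distribˡ-sum; *-distribʳ-sum)
  open import Algebra.Properties.CommutativeMonoid.Mult ℕ.+-0-commutativeMonoid
    renaming (_×_ to _×ℕ_) using ()

  ×ℕ≡* : ∀ k x → k ×ℕ x ≡ k ℕ.* x
  ×ℕ≡* zero    x = refl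
  ×ℕ≡* (suc k) x = cong (x ℕ.+_) (×ℕ≡* k x)

  -- The natural number weights of the complete graph: 1 on each pair (x,y) with
  -- x < y, and 0 otherwise.
  υ : Fin n → Fin n → ℕ
  υ x y = if ⌊ x Fin.<? y ⌋ then 1 else 0

  υ-diagonal : ∀ x → υ x x ≡ 0
  υ-diagonal x with x Fin.<? x
  ... | yes x<x = ⊥-elim (Fin.<-irrefl refl x<x)
  ... | no _    = refl

  υ-swap : ∀ {x y} → x ≢ y → υ x y ℕ.+ υ y x ≡ 1
  υ-swap {x} {y} x≢y with x Fin.<? y | y Fin.<? x
  ... | yes x<y | yes y<x = ⊥-elim (Fin.<-asym x<y y<x)
  ... | yes _   | no _    = refl
  ... | no _    | yes _   = refl
  ... | no x≮y  | no y≮x  with Fin.<-cmp x y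
  ...   | tri< x<y _ _ = ⊥-elim (x≮y x<y)
  ...   | tri≈ _ x≡y _ = ⊥-elim (x≢y x≡y)
  ...   | tri> _ _ y<x = ⊥-elim (y≮x y<x)

  open Offdiagonal υ υ-diagonal

  -- Each pair of points in p and q is weighted in exactly one of its two orders.
  cut≡ : ∀ {p q} → Empty (p ∩ q) → cut p q ≡ ∣ p ∣ ℕ.* ∣ q ∣
  cut≡ {p} {q} p∩q≡∅ = begin
    cut p q
      ≡⟨ ⟨∣⟩-+ υ (λ x y → χ p x ℕ.* χ q y) (λ x y → χ q x ℕ.* χ p y) ⟩
    ⟨ υ ∣ (λ x y → χ p x ℕ.* χ q y) ⟩ ℕ.+ ⟨ υ ∣ (λ x y → χ q x ℕ.* χ p y) ⟩
      ≡⟨ cong (⟨ υ ∣ (λ x y → χ p x ℕ.* χ q y) ⟩ ℕ.+_)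
           (sumℕ-comm (λ x y → (χ q x ℕ.* χ p y) ×ℕ υ x y)) ⟩
    ⟨ υ ∣ (λ x y → χ p x ℕ.* χ q y) ⟩ ℕ.+
      sumℕ (λ x → sumℕ λ y → (χ q y ℕ.* χ p x) ×ℕ υ y x)
      ≡⟨ sumℕ-+ (λ x → sumℕ λ y → (χ p x ℕ.* χ q y) ×ℕ υ x y)
                (λ x → sumℕ λ y → (χ q y ℕ.* χ p x) ×ℕ υ y x) ⟨
    sumℕ (λ x → sumℕ (λ y → (χ p x ℕ.* χ q y) ×ℕ υ x y) ℕ.+
                sumℕ (λ y → (χ q y ℕ.* χ p x) ×ℕ υ y x))
      ≡⟨ sumℕ-cong (λ x → sumℕ-+ (λ y → (χ p x ℕ.* χ q y) ×ℕ υ x y)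
                                (λ y → (χ q y ℕ.* χ p x) ×ℕ υ y x)) ⟨
    sumℕ (λ x → sumℕ λ y → (χ p x ℕ.* χ q y) ×ℕ υ x y ℕ.+ (χ q y ℕ.* χ p x) ×ℕ υ y x)
      ≡⟨ sumℕ-cong (λ x → sumℕ-cong (λ y → term x y)) ⟩
    sumℕ (λ x → sumℕ λ y → χ p x ℕ.* χ q y)
      ≡⟨ sumℕ-cong (λ x → *-distribˡ-sum (χ p x) (χ q)) ⟨
    sumℕ (λ x → χ p x ℕ.* sumℕ (χ q))
      ≡⟨ *-distribʳ-sum (sumℕ (χ q)) (χ p) ⟨
    sumℕ (χ p) ℕ.* sumℕ (χ q)
      ≡⟨ cong₂ ℕ._*_ (sum-χ p) (sum-χ q) ⟩
    ∣ p ∣ ℕ.* ∣ q ∣ ∎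
    where
    open ≡-Reasoning
    disjoint : ∀ x → χ p x ℕ.* χ q x ≡ 0
    disjoint x with position p∩q≡∅ x
    ... | inˡ _ _ b _ rewrite b = ℕ.*-zeroʳ (χ p x)
    ... | inʳ _ a _ _ rewrite a = refl
    ... | neither a _ _  rewrite a = refl
    factor-out : ∀ a b u v → (a ℕ.* b) ℕ.* u ℕ.+ (b ℕ.* a) ℕ.* v ≡ (a ℕ.* b) ℕ.* (u ℕ.+ v)
    factor-out = solve-∀
    term : ∀ x y → (χ p x ℕ.* χ q y) ×ℕ υ x y ℕ.+ (χ q y ℕ.* χ p x) ×ℕ υ y x ≡ χ p x ℕ.* χ q y
    term x y = trans (trans
        (cong₂ ℕ._+_ (×ℕ≡* (χ p x ℕ.* χ q y) (υ x y)) (×ℕ≡* (χ q y ℕ.* χ p x) (υ y x)))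
        (factor-out (χ p x) (χ q y) (υ x y) (υ y x))) (finish (x Fin.≟ y))
      where
      finish : Dec (x ≡ y) → χ p x ℕ.* χ q y ℕ.* (υ x y ℕ.+ υ y x) ≡ χ p x ℕ.* χ q y
      finish (yes refl) rewrite disjoint x = refl
      finish (no x≢y) rewrite υ-swap x≢y = ℕ.*-identityʳ _

  inner-complete : ∀ {s} → Tree s → 2 ℕ.* inner s ℕ.+ ∣ s ∣ ≡ ∣ s ∣ ℕ.* ∣ s ∣
  inner-complete (leaf v) rewrite inner-⁅⁆ v | ∣⁅x⁆∣≡1 v = refl
  inner-complete (node {p} {q} p∩q≡∅ l r)
    rewrite inner-∪ p∩q≡∅ | cut≡ p∩q≡∅ | ∣p∪q∣≡∣p∣+∣q∣ p∩q≡∅ = begin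
    2 ℕ.* (inner p ℕ.+ inner q ℕ.+ ∣ p ∣ ℕ.* ∣ q ∣) ℕ.+ (∣ p ∣ ℕ.+ ∣ q ∣)
      ≡⟨ regroup (inner p) (inner q) ∣ p ∣ ∣ q ∣ ⟩
    (2 ℕ.* inner p ℕ.+ ∣ p ∣) ℕ.+ (2 ℕ.* inner q ℕ.+ ∣ q ∣) ℕ.+ 2 ℕ.* (∣ p ∣ ℕ.* ∣ q ∣)
      ≡⟨ cong₂ (λ a b → a ℕ.+ b ℕ.+ 2 ℕ.* (∣ p ∣ ℕ.* ∣ q ∣)) (inner-complete l) (inner-complete r) ⟩
    ∣ p ∣ ℕ.* ∣ p ∣ ℕ.+ ∣ q ∣ ℕ.* ∣ q ∣ ℕ.+ 2 ℕ.* (∣ p ∣ ℕ.* ∣ q ∣)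
      ≡⟨ square ∣ p ∣ ∣ q ∣ ⟩
    (∣ p ∣ ℕ.+ ∣ q ∣) ℕ.* (∣ p ∣ ℕ.+ ∣ q ∣) ∎
    where
    open ≡-Reasoning
    regroup : ∀ i j a b → 2 ℕ.* (i ℕ.+ j ℕ.+ a ℕ.* b) ℕ.+ (a ℕ.+ b) ≡
              (2 ℕ.* i ℕ.+ a) ℕ.+ (2 ℕ.* j ℕ.+ b) ℕ.+ 2 ℕ.* (a ℕ.* b)
    regroup = solve-∀
    square : ∀ a b → a ℕ.* a ℕ.+ b ℕ.* b ℕ.+ 2 ℕ.* (a ℕ.* b) ≡ (a ℕ.+ b) ℕ.* (a ℕ.+ b)
    square = solve-∀

  cost-complete : ∀ {s} (t : Tree s) → 3 ℕ.* cost t ℕ.+ ∣ s ∣ ≡ ∣ s ∣ ℕ.* ∣ s ∣ ℕ.* ∣ s ∣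
  cost-complete (leaf v) rewrite cost-leaf v | ∣⁅x⁆∣≡1 v = refl
  cost-complete (node {p} {q} p∩q≡∅ l r)
    rewrite cost-node p∩q≡∅ l r | cut≡ p∩q≡∅ | ∣p∪q∣≡∣p∣+∣q∣ p∩q≡∅
          | ×ℕ≡* (∣ p ∣ ℕ.+ ∣ q ∣) (∣ p ∣ ℕ.* ∣ q ∣) = begin
    3 ℕ.* (cost l ℕ.+ cost r ℕ.+ (a ℕ.+ b) ℕ.* (a ℕ.* b)) ℕ.+ (a ℕ.+ b)
      ≡⟨ regroup (cost l) (cost r) a b ⟩
    (3 ℕ.* cost l ℕ.+ a) ℕ.+ (3 ℕ.* cost r ℕ.+ b) ℕ.+ 3 ℕ.* ((a ℕ.+ b) ℕ.* (a ℕ.* b))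
      ≡⟨ cong₂ (λ i j → i ℕ.+ j ℕ.+ 3 ℕ.* ((a ℕ.+ b) ℕ.* (a ℕ.* b)))
           (cost-complete l) (cost-complete r) ⟩
    a ℕ.* a ℕ.* a ℕ.+ b ℕ.* b ℕ.* b ℕ.+ 3 ℕ.* ((a ℕ.+ b) ℕ.* (a ℕ.* b))
      ≡⟨ cube a b ⟩
    (a ℕ.+ b) ℕ.* (a ℕ.+ b) ℕ.* (a ℕ.+ b) ∎
    where
    open ≡-Reasoning
    a = ∣ p ∣
    b = ∣ q ∣
    regroup : ∀ i j a b → 3 ℕ.* (i ℕ.+ j ℕ.+ (a ℕ.+ b) ℕ.* (a ℕ.* b)) ℕ.+ (a ℕ.+ b) ≡
              (3 ℕ.* i ℕ.+ a) ℕ.+ (3 ℕ.* j ℕ.+ b) ℕ.+ 3 ℕ.* ((a ℕ.+ b) ℕ.* (a ℕ.* b))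
    regroup = solve-∀
    cube : ∀ a b → a ℕ.* a ℕ.* a ℕ.+ b ℕ.* b ℕ.* b ℕ.+ 3 ℕ.* ((a ℕ.+ b) ℕ.* (a ℕ.* b)) ≡
           (a ℕ.+ b) ℕ.* (a ℕ.+ b) ℕ.* (a ℕ.+ b)
    cube = solve-∀

  -- For c = cost t and e = inner ⊤, both 3 c + n + n² and (n + 1) (2 e + n) are
  -- equal to n³ + n².
  3cost≡ : ∀ (t : Tree (⊤ {n})) → 3 ℕ.* cost t ≡ 2 ℕ.* suc n ℕ.* inner ⊤
  3cost≡ t = ℕ.+-cancelʳ-≡ (n ℕ.+ n ℕ.* n) _ _ (begin
    3 ℕ.* c ℕ.+ (n ℕ.+ n ℕ.* n)
      ≡⟨ ℕ.+-assoc (3 ℕ.* c) n (n ℕ.* n) ⟨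
    3 ℕ.* c ℕ.+ n ℕ.+ n ℕ.* n
      ≡⟨ cong (ℕ._+ n ℕ.* n)
           (subst (λ k → 3 ℕ.* c ℕ.+ k ≡ k ℕ.* k ℕ.* k) (∣⊤∣≡n n) (cost-complete t)) ⟩
    n ℕ.* n ℕ.* n ℕ.+ n ℕ.* n
      ≡⟨ factor-out n ⟩
    suc n ℕ.* (n ℕ.* n)
      ≡⟨ cong (suc n ℕ.*_)
           (subst (λ k → 2 ℕ.* i ℕ.+ k ≡ k ℕ.* k) (∣⊤∣≡n n) (inner-complete t)) ⟨
    suc n ℕ.* (2 ℕ.* i ℕ.+ n)
      ≡⟨ regroup n i ⟩
    2 ℕ.* suc n ℕ.* i ℕ.+ (n ℕ.+ n ℕ.* n) ∎)
    where
    open ≡-Reasoning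
    c = cost t
    i = inner ⊤
    factor-out : ∀ k → k ℕ.* k ℕ.* k ℕ.+ k ℕ.* k ≡ suc k ℕ.* (k ℕ.* k)
    factor-out = solve-∀
    regroup : ∀ k i → suc k ℕ.* (2 ℕ.* i ℕ.+ k) ≡ 2 ℕ.* suc k ℕ.* i ℕ.+ (k ℕ.+ k ℕ.* k)
    regroup = solve-∀

  private
    module ℝP = Pairing ℝ-monoid
  open EdgeSums (K n) using (ω; dasguptaCost≃cost; totalWeight; totalWeight≃inner)

  fromℕ-+ : ∀ a b → fromℕ (a ℕ.+ b) ≃ fromℕ a + fromℕ b
  fromℕ-+ a b = ×-homo-+ 1ℝ a b

  fromℕ-sum : ∀ {m} (f : Fin m → ℕ) → fromℕ (sumℕ f) ≃ sum (λ i → fromℕ (f i))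
  fromℕ-sum {zero}  f = ≃-refl {0ℝ}
  fromℕ-sum {suc m} f = begin-equality
    fromℕ (f Fin.zero ℕ.+ sumℕ λ i → f (Fin.suc i))
      ≈⟨ fromℕ-+ (f Fin.zero) (sumℕ λ i → f (Fin.suc i)) ⟩
    fromℕ (f Fin.zero) + fromℕ (sumℕ λ i → f (Fin.suc i))
      ≈⟨ +-cong (fromℕ (f Fin.zero)) (fromℕ (f Fin.zero))
           (fromℕ (sumℕ λ i → f (Fin.suc i))) (sum λ i → fromℕ (f (Fin.suc i)))
           (≃-refl {fromℕ (f Fin.zero)})
           (fromℕ-sum λ i → f (Fin.suc i)) ⟩
    fromℕ (f Fin.zero) + sum (λ i → fromℕ (f (Fin.suc i))) ∎
    where open ℝ-Reasoning

  ω≃υ : ∀ x y → fromℕ (υ x y) ≃ ω x y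
  ω≃υ x y with x Fin.<? y | T? (WeightedGraph.adjacent (K n) x y)
  ... | yes _   | yes _ = termwise (fromℕ 1) (1ℝ * 1ℝ) λ _ → refl
  ... | yes x<y | no ¬e = ⊥-elim (¬e (distinct (x Fin.≟ y)))
    where
    distinct : (d : Dec (x ≡ y)) → T (not ⌊ d ⌋)
    distinct (yes refl) = ⊥-elim (Fin.<-irrefl refl x<y)
    distinct (no _)     = _
  ... | no _    | _     = ≃-refl {0ℝ}

  fromℕ-⟨∣⟩ : ∀ c → fromℕ ⟨ υ ∣ c ⟩ ≃ ℝP.⟨ ω ∣ c ⟩
  fromℕ-⟨∣⟩ c = begin-equality
    fromℕ ⟨ υ ∣ c ⟩
      ≈⟨ fromℕ-sum (λ x → sumℕ λ y → c x y ×ℕ υ x y) ⟩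
    sum (λ x → fromℕ (sumℕ λ y → c x y ×ℕ υ x y))
      ≈⟨ sum-cong-≃ _ _ (λ x → fromℕ-sum (λ y → c x y ×ℕ υ x y)) ⟩
    sum (λ x → sum λ y → fromℕ (c x y ×ℕ υ x y))
      ≈⟨ sum-cong-≃ _ _ (λ x → sum-cong-≃ _ _ (λ y → term x y)) ⟩
    ℝP.⟨ ω ∣ c ⟩ ∎
    where
    open ℝ-Reasoning
    term : ∀ x y → fromℕ (c x y ×ℕ υ x y) ≃ c x y · ω x y
    term x y = begin-equality
      fromℕ (c x y ×ℕ υ x y)      ≡⟨ cong fromℕ (×ℕ≡* (c x y) (υ x y)) ⟩
      fromℕ (c x y ℕ.* υ x y)     ≈⟨ ×-assocˡ 1ℝ (c x y) (υ x y) ⟨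
      c x y · fromℕ (υ x y)       ≈⟨ ×-congʳ (c x y) {fromℕ (υ x y)} {ω x y} (ω≃υ x y) ⟩
      c x y · ω x y               ∎

  dasguptaCost-complete : ∀ t → fromℕ (cost t) ≃ dasguptaCost (K n) t
  dasguptaCost-complete t = begin-equality
    fromℕ (cost t)               ≈⟨ fromℕ-⟨∣⟩ (lcaSize t) ⟩
    EdgeSums.cost (K n) t        ≈⟨ dasguptaCost≃cost t ⟨
    dasguptaCost (K n) t         ∎
    where open ℝ-Reasoning

  totalWeight-complete : fromℕ (inner ⊤) ≃ totalWeight
  totalWeight-complete = begin-equality
    fromℕ (inner ⊤)              ≈⟨ fromℕ-⟨∣⟩ (within ⊤) ⟩
    EdgeSums.inner (K n) ⊤       ≈⟨ totalWeight≃inner ⟨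
    totalWeight                  ∎
    where open ℝ-Reasoning

  -- Every hierarchy of the complete graph has the same cost.
  3dasguptaCost≃ : ∀ t → 3 · dasguptaCost (K n) t ≃ (2 ℕ.* suc n) · totalWeight
  3dasguptaCost≃ t = begin-equality
    3 · dasguptaCost (K n) t
      ≈⟨ ×-congʳ 3 {fromℕ (cost t)} {dasguptaCost (K n) t} (dasguptaCost-complete t) ⟨
    3 · fromℕ (cost t)
      ≈⟨ ×-assocˡ 1ℝ 3 (cost t) ⟩
    fromℕ (3 ℕ.* cost t)
      ≡⟨ cong fromℕ (3cost≡ t) ⟩
    fromℕ (2 ℕ.* suc n ℕ.* inner ⊤)
      ≈⟨ ×-assocˡ 1ℝ (2 ℕ.* suc n) (inner ⊤) ⟨
    (2 ℕ.* suc n) · fromℕ (inner ⊤)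
      ≈⟨ ×-congʳ (2 ℕ.* suc n) {fromℕ (inner ⊤)} {totalWeight} totalWeight-complete ⟩
    (2 ℕ.* suc n) · totalWeight ∎
    where open ℝ-Reasoning

-- Ultrametrics with natural values

-- The ultrametrics with values in ℕ. Positivity on distinct points and the strong
-- triangle inequality are stated in ℕ, with the maximum of naturals.
record IsIntegralUltrametric (f : Fin n → Fin n → ℕ) : Set where
  field
    zero-self : ∀ x → f x x ≡ 0
    positive  : ∀ x y → x ≢ y → 1 ℕ.≤ f x y
    symmetric : ∀ x y → f x y ≡ f y x
    strong    : ∀ x y z → f x z ℕ.≤ f x y ℕ.⊔ f y z

fromℕ-cong : ∀ {a b} → a ≡ b → fromℕ a ≃ fromℕ b
fromℕ-cong {a} refl = ≃-refl {fromℕ a}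

integral⇒ultrametric : ∀ (f : Fin n → Fin n → ℕ) → IsIntegralUltrametric f →
                       IsUltrametric (λ x y → fromℕ (f x y))
integral⇒ultrametric f isIntegral = record
  { isSemiMetric = record
    { isQuasiSemiMetric = record
      { isPreMetric = record
        { isProtoMetric = record
          { isPartialOrder  = ≤-isPartialOrder
          ; ≈-isEquivalence = ≡.isEquivalence
          ; cong            = λ { {x} {_} {y} refl refl → ≃-refl {fromℕ (f x y)} }
          ; nonNegative     = λ {x} {y} → fromℕ-mono-≤ {0} {f x y} z≤n
          }
        ; ≈⇒0 = λ { {x} refl → fromℕ-cong (zero-self x) }
        }
      ; 0⇒≈ = λ {x} {y} → definite x y
      }
    ; sym = λ x y → fromℕ-cong (symmetric x y)
    }
  ; triangle = λ x y z → termwise-≤ (fromℕ (f x z)) (fromℕ (f x y) ⊔ fromℕ (f y z))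
      (bound (f x z) (f x y) (f y z) (strong x y z))
  }
  where
  open IsIntegralUltrametric isIntegral
  definite : ∀ x y → fromℕ (f x y) ≃ 0ℝ → x ≡ y
  definite x y f≃0 with x Fin.≟ y
  ... | yes x≡y = x≡y
  ... | no  x≢y = ⊥-elim (≤-trans {fromℕ 1} {fromℕ (f x y)} {0ℝ}
    (fromℕ-mono-≤ (positive x y x≢y)) (≃⇒≤ {fromℕ (f x y)} {0ℝ} f≃0) (0<fromℕ-suc 0))
  bound : ∀ a b c → a ℕ.≤ b ℕ.⊔ c → ∀ i →
          seq (fromℕ a) i ℚ.≤ seq (fromℕ b) i ℚ.⊔ seq (fromℕ c) i
  bound a b c a≤ i with ℕ.⊔-sel b c
  ... | inj₁ eq = ℚ.≤-trans (fromℕ-mono (subst (a ℕ.≤_) eq a≤) i) (ℚ.p≤p⊔q _ _)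
  ... | inj₂ eq = ℚ.≤-trans (fromℕ-mono (subst (a ℕ.≤_) eq a≤) i) (ℚ.p≤q⊔p (seq (fromℕ b) i) _)

integral-dominating : ∀ (G : WeightedGraph n) (f : Fin n → Fin n → ℕ) → IsIntegralUltrametric f →
  (∀ x y k → IsDistance G x y k → k ℕ.≤ f x y) → DominatingUltrametric G
integral-dominating G f isIntegral dist≤f = record
  { u             = λ x y → fromℕ (f x y)
  ; isUltrametric = integral⇒ultrametric f isIntegral
  ; dominates     = λ x y k d → fromℕ-mono-≤ (dist≤f x y k d)
  }

-- Constant value c off the diagonal, which is an ultrametric for c ≥ 1.
uniform : ℕ → Fin n → Fin n → ℕ
uniform c x y = if ⌊ x Fin.≟ y ⌋ then 0 else c

uniform-isIntegral : ∀ c → 1 ℕ.≤ c → IsIntegralUltrametric {n} (uniform c)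
uniform-isIntegral c 1≤c = record
  { zero-self = zero-self ; positive = positive ; symmetric = symmetric ; strong = strong }
  where
  zero-self : ∀ x → uniform c x x ≡ 0
  zero-self x with x Fin.≟ x
  ... | yes _  = refl
  ... | no x≢x = ⊥-elim (x≢x refl)
  positive : ∀ x y → x ≢ y → 1 ℕ.≤ uniform c x y
  positive x y x≢y with x Fin.≟ y
  ... | yes x≡y = ⊥-elim (x≢y x≡y)
  ... | no _    = 1≤c
  symmetric : ∀ x y → uniform c x y ≡ uniform c y x
  symmetric x y with x Fin.≟ y | y Fin.≟ x
  ... | yes _   | yes _   = refl
  ... | no _    | no _    = refl
  ... | yes x≡y | no y≢x  = ⊥-elim (y≢x (sym x≡y))
  ... | no x≢y  | yes y≡x = ⊥-elim (x≢y (sym y≡x))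
  strong : ∀ x y z → uniform c x z ℕ.≤ uniform c x y ℕ.⊔ uniform c y z
  strong x y z with x Fin.≟ z | x Fin.≟ y | y Fin.≟ z
  ... | yes _  | _        | _        = z≤n
  ... | no _   | no _     | _        = ℕ.m≤m⊔n c _
  ... | no _   | yes _    | no _     = ℕ.≤-refl
  ... | no x≢z | yes refl | yes refl = ⊥-elim (x≢z refl)

uniform-dominating : ∀ (G : WeightedGraph n) c → 1 ℕ.≤ c →
  (∀ x y k → IsDistance G x y k → k ℕ.≤ c) → DominatingUltrametric G
uniform-dominating G c 1≤c dist≤c = integral-dominating G (uniform c) (uniform-isIntegral c 1≤c) bound
  where
  bound : ∀ x y k → IsDistance G x y k → k ℕ.≤ uniform c x y
  bound x y k d with x Fin.≟ y
  ... | yes refl = proj₂ d 0 []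
  ... | no _     = dist≤c x y k d

-- Optimal values of the complete graph

module _ {n : ℕ} (2≤n : 2 ℕ.≤ n) where

  open EdgeSums (K n) using (one; totalWeight; totalWeight≤; 0<totalWeight; edgeSum-cong; edge-distance)

  K-adjacent : ∀ {x y : Fin n} → x ≢ y → WeightedGraph._~_ (K n) x y
  K-adjacent {x} {y} x≢y with x Fin.≟ y
  ... | yes x≡y = ⊥-elim (x≢y x≡y)
  ... | no _    = _

  K-walk : ∀ x y → ∃ λ k → k ℕ.≤ 1 × Walk (K n) x y k
  K-walk x y with x Fin.≟ y
  ... | yes refl = 0 , z≤n , []
  ... | no x≢y   = 1 , s≤s z≤n , K-adjacent x≢y ∷ []

  K-connected : Connected (K n)
  K-connected x y with K-walk x y
  ... | k , _ , w = k , w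

  K-discrete : DominatingUltrametric (K n)
  K-discrete = uniform-dominating (K n) 1 (s≤s z≤n) λ x y k d →
    let (j , j≤1 , w) = K-walk x y in ℕ.≤-trans (proj₂ d j w) j≤1

  K-OPT-free : IsOPT-free (K n) totalWeight
  K-OPT-free = (K-discrete , edgeSum-cong _ one unit) , totalWeight≤
    where
    unit : ∀ x y → WeightedGraph._~_ (K n) x y → fromℕ (uniform 1 x y) ≃ 1ℝ
    unit x y e with x Fin.≟ y
    ... | yes refl = ⊥-elim e
    ... | no _     = termwise (fromℕ 1) 1ℝ λ _ → refl

  K-OPT-D : ∀ t → IsOPT-D (K n) (dasguptaCost (K n) t)
  K-OPT-D t = (t , ≃-refl {dasguptaCost (K n) t}) , λ t′ →
    ·-cancel-≤ 2 (dasguptaCost (K n) t) (dasguptaCost (K n) t′) (begin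
      3 · dasguptaCost (K n) t       ≈⟨ Complete.3dasguptaCost≃ t ⟩
      (2 ℕ.* suc n) · totalWeight    ≈⟨ Complete.3dasguptaCost≃ t′ ⟨
      3 · dasguptaCost (K n) t′      ∎)
    where open ℝ-Reasoning

  K-ratio : ∃ λ D → ∃ λ F → IsOPT-D (K n) D × IsOPT-free (K n) F
    × Σ (0ℝ < F) λ 0<F → D ÷ F [ 0<F ] ≃ factor n
  K-ratio = D , totalWeight , K-OPT-D t , K-OPT-free , 0<W ,
    ÷-≃ totalWeight 0<W D (factor n) (≃-factor n D totalWeight (Complete.3dasguptaCost≃ t))
    where
    t = hierarchy (ℕ.≤-trans (s≤s z≤n) 2≤n)
    D = dasguptaCost (K n) t
    0<W = 0<totalWeight 2≤n K-connected

-- Existence of optimal values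

-- Among finitely many candidates satisfying P, one has the least value.
finite-minimum : ExcludedMiddle 0ℓ → ∀ {N} (P : Fin N → Set) (c : Fin N → ℝ) → ∃ P →
                 ∃ λ k → P k × (∀ j → P j → c k ≤ c j)
finite-minimum em {suc N} P c (i , Pi) with em {∃ λ j → P (Fin.suc j)}
... | no none = k₀ i Pi
  where
  k₀ : ∀ i → P i → ∃ λ k → P k × (∀ j → P j → c k ≤ c j)
  k₀ (Fin.suc i) Pi = ⊥-elim (none (i , Pi))
  k₀ Fin.zero    P0 = Fin.zero , P0 , λ
    { Fin.zero    _  → ≤-refl (c Fin.zero)
    ; (Fin.suc j) Pj → ⊥-elim (none (j , Pj)) }
... | yes some with finite-minimum em (λ j → P (Fin.suc j)) (λ j → c (Fin.suc j)) some
...   | k , Pk , c≤ with em {P Fin.zero} | em {c (Fin.suc k) < c Fin.zero}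
...     | no ¬P0 | _       = Fin.suc k , Pk , λ
  { Fin.zero P0 → ⊥-elim (¬P0 P0) ; (Fin.suc j) Pj → c≤ j Pj }
...     | yes _  | yes k<0 = Fin.suc k , Pk , λ
  { Fin.zero _ → <⇒≤ (c (Fin.suc k)) (c Fin.zero) k<0 ; (Fin.suc j) Pj → c≤ j Pj }
...     | yes P0 | no k≮0  = Fin.zero , P0 , λ
  { Fin.zero _ → ≤-refl (c Fin.zero)
  ; (Fin.suc j) Pj → ≤-trans {c Fin.zero} {c (Fin.suc k)} {c (Fin.suc j)} k≮0 (c≤ j Pj) }

-- A numbering of the n × n matrices of naturals with entries at most M, of which
-- there are ((M + 1) ^ n) ^ n.
decode : ∀ {n M} → Fin ((suc M ℕ.^ n) ℕ.^ n) → Fin n → Fin n → ℕ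
decode {n} {M} k x y = toℕ (finToFun {suc M} {n} (finToFun {suc M ℕ.^ n} {n} k x) y)

encode : ∀ {M} (f : Fin n → Fin n → ℕ) → (∀ x y → f x y ℕ.≤ M) →
         ∃ λ k → ∀ x y → decode {n} {M} k x y ≡ f x y
encode {n} {M} f f≤M = funToFin row , λ x y → begin
  toℕ (finToFun (finToFun (funToFin row) x) y)
    ≡⟨ cong (λ r → toℕ (finToFun {suc M} {n} r y)) (Fin.finToFun-funToFin row x) ⟩
  toℕ (finToFun (funToFin (entry x)) y)
    ≡⟨ cong toℕ (Fin.finToFun-funToFin (entry x) y) ⟩
  toℕ (entry x y)
    ≡⟨ Fin.toℕ-fromℕ< (s≤s (f≤M x y)) ⟩
  f x y ∎
  where
  open ≡-Reasoning
  entry : Fin n → Fin n → Fin (suc M)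
  entry x y = fromℕ< (s≤s (f≤M x y))
  row : Fin n → Fin (suc M ℕ.^ n)
  row x = funToFin (entry x)

-- A cost is minimised if every candidate can be replaced by one that costs no
-- more and whose cost lies in a fixed finite list.
minimum-from-list : ExcludedMiddle 0ℓ → ∀ {A : Set} (cost : A → ℝ) {N} (c : Fin N → ℝ) → A →
  (∀ a → ∃ λ k → (∃ λ b → cost b ≃ c k) × c k ≤ cost a) → ∃ (IsMinimum cost)
minimum-from-list em cost c a₀ replace = from-minimum
  (finite-minimum em (λ k → ∃ λ b → cost b ≃ c k) c
    (proj₁ (replace a₀) , proj₁ (proj₂ (replace a₀))))
  where
  from-minimum : (∃ λ k → (∃ λ b → cost b ≃ c k) × (∀ j → (∃ λ b → cost b ≃ c j) → c k ≤ c j)) →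
                 ∃ (IsMinimum cost)
  from-minimum (k , Pk , c≤) = c k , Pk , λ a → below a (replace a)
    where
    below : ∀ a → (∃ λ j → (∃ λ b → cost b ≃ c j) × c j ≤ cost a) → c k ≤ cost a
    below a (j , Pj , cⱼ≤) = ≤-trans {c k} {c j} {cost a} (c≤ j Pj) cⱼ≤

-- For costs that are edge sums, the list may consist of the edge sums of all
-- matrices of naturals with entries at most M.
minimum-exists : ExcludedMiddle 0ℓ → ∀ (G : WeightedGraph n) M {A : Set} (cost : A → ℝ) → A →
  (∀ a → ∃ λ f → (∀ x y → f x y ℕ.≤ M)
    × (∃ λ b → cost b ≃ edgeSum G λ x y → fromℕ (f x y))
    × (edgeSum G λ x y → fromℕ (f x y)) ≤ cost a) →
  ∃ (IsMinimum cost)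
minimum-exists {n} em G M cost a₀ replace =
  minimum-from-list em cost c a₀ λ a → recode a (replace a)
  where
  value : (Fin n → Fin n → ℕ) → ℝ
  value f = edgeSum G λ x y → fromℕ (f x y)

  c : Fin ((suc M ℕ.^ n) ℕ.^ n) → ℝ
  c k = value (decode {n} {M} k)

  recode : ∀ a → (∃ λ f → (∀ x y → f x y ℕ.≤ M) × (∃ λ b → cost b ≃ value f) × value f ≤ cost a) →
           ∃ λ k → (∃ λ b → cost b ≃ c k) × c k ≤ cost a
  recode a (f , f≤M , (b , b≃) , ≤a) = from-code (encode f f≤M)
    where
    from-code : (∃ λ k → ∀ x y → decode {n} {M} k x y ≡ f x y) →
                ∃ λ k → (∃ λ b → cost b ≃ c k) × c k ≤ cost a
    from-code (k , eq) = k , (b , ≃-trans (cost b) (value f) (c k) b≃ (≃-sym (c k) (value f) c≃))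
                           , ≤-trans {c k} {value f} {cost a} (≃⇒≤ {c k} {value f} c≃) ≤a
      where
      c≃ : c k ≃ value f
      c≃ = EdgeSums.edgeSum-cong G (λ x y → fromℕ (decode {n} {M} k x y)) (λ x y → fromℕ (f x y))
        λ x y _ → fromℕ-cong (eq x y)

-- The costs of hierarchies are edge sums of cluster sizes, which are at most n.
OPT-D-exists : ExcludedMiddle 0ℓ → ∀ (G : WeightedGraph n) → 1 ℕ.≤ n → ∃ (IsOPT-D G)
OPT-D-exists {n} em G 1≤n = minimum-exists em G n (dasguptaCost G) (hierarchy 1≤n) λ t →
    (λ x y → ∣ lcaCluster t x y ∣)
  , (λ x y → ∣p∣≤n (lcaCluster t x y))
  , (t , ≃-refl {dasguptaCost G t})
  , ≤-refl (dasguptaCost G t)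

-- The bound b on k only drives the recursion.
least : ExcludedMiddle 0ℓ → ∀ (P : ℕ → Set) b k → k ℕ.≤ b → P k →
        ∃ λ m → P m × (∀ j → P j → m ℕ.≤ j)
least em P b k k≤b Pk with em {∃ λ j → j ℕ.< k × P j}
... | no none = k , Pk , λ j Pj → ℕ.≮⇒≥ λ j<k → none (j , j<k , Pj)
least em P zero    k k≤b Pk | yes (j , j<k , Pj) = ⊥-elim (ℕ.n≮0 (ℕ.<-≤-trans j<k k≤b))
least em P (suc b) k k≤b Pk | yes (j , j<k , Pj) =
  least em P b j (ℕ.≤-pred (ℕ.≤-trans j<k k≤b)) Pj

upper-bound : ∀ {m} (f : Fin m → ℕ) → ∃ λ M → ∀ i → f i ℕ.≤ M
upper-bound {zero}  f = 0 , λ ()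
upper-bound {suc m} f with upper-bound (λ i → f (Fin.suc i))
... | M , f≤M = f Fin.zero ℕ.⊔ M , λ
  { Fin.zero → ℕ.m≤m⊔n _ M ; (Fin.suc i) → ℕ.≤-trans (f≤M i) (ℕ.m≤n⊔m (f Fin.zero) M) }

-- Rounding down ultrametrics

module Rounding (em : ExcludedMiddle 0ℓ) where

  -- k is the largest natural number that is at most x and at most M.
  IsFloor : ℕ → ℝ → ℕ → Set
  IsFloor M x k = k ℕ.≤ M × fromℕ k ≤ x × (∀ j → j ℕ.≤ M → fromℕ j ≤ x → j ℕ.≤ k)

  floor : ∀ M x → 0ℝ ≤ x → ∃ (IsFloor M x)
  floor zero    x 0≤x = 0 , z≤n , 0≤x , λ j j≤0 _ → j≤0
  floor (suc M) x 0≤x with em {fromℕ (suc M) ≤ x}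
  ... | yes M≤x = suc M , ℕ.≤-refl , M≤x , λ j j≤M _ → j≤M
  ... | no  M≰x with floor M x 0≤x
  ...   | k , k≤M , k≤x , largest = k , ℕ.m≤n⇒m≤1+n k≤M , k≤x , below
    where
    below : ∀ j → j ℕ.≤ suc M → fromℕ j ≤ x → j ℕ.≤ k
    below j j≤ j≤x with ℕ.m≤n⇒m<n∨m≡n j≤
    ... | inj₁ j<     = largest j (ℕ.≤-pred j<) j≤x
    ... | inj₂ refl   = ⊥-elim (M≰x j≤x)

  ≤-⊔ : ∀ x y z → x ≤ y ⊔ z → x ≤ y ⊎ x ≤ z
  ≤-⊔ x y z x≤ with em {y < z}
  ... | yes y<z = inj₂ (≤-trans {x} {y ⊔ z} {z} x≤ (⊔-lub y z z (<⇒≤ y z y<z) (≤-refl z)))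
  ... | no  y≮z = inj₁ (≤-trans {x} {y ⊔ z} {y} x≤ (⊔-lub y z y (≤-refl y) y≮z))

  module _ (G : WeightedGraph n) (M : ℕ)
           (distance : ∀ x y → ∃ λ k → k ℕ.≤ M × IsDistance G x y k)
           (U : DominatingUltrametric G) where

    open DominatingUltrametric U
    open IsGeneralMetric isUltrametric using (nonNegative; ≈⇒0; triangle) renaming (sym to u-sym)

    private
      fl : ∀ x y → ∃ (IsFloor M (u x y))
      fl x y = floor M (u x y) (nonNegative {x} {y})

    -- The ultrametric of U rounded down, with the cap M.
    rounded : Fin n → Fin n → ℕ
    rounded x y = proj₁ (fl x y)

    rounded≤M : ∀ x y → rounded x y ℕ.≤ M
    rounded≤M x y = proj₁ (proj₂ (fl x y))

    rounded≤u : ∀ x y → fromℕ (rounded x y) ≤ u x y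
    rounded≤u x y = proj₁ (proj₂ (proj₂ (fl x y)))

    rounded-largest : ∀ x y j → j ℕ.≤ M → fromℕ j ≤ u x y → j ℕ.≤ rounded x y
    rounded-largest x y = proj₂ (proj₂ (proj₂ (fl x y)))

    -- Graph distances are naturals and at most M, so rounding respects them.
    distance≤rounded : ∀ x y k → IsDistance G x y k → k ℕ.≤ rounded x y
    distance≤rounded x y k d = rounded-largest x y k (k≤M (distance x y)) (dominates x y k d)
      where
      k≤M : (∃ λ j → j ℕ.≤ M × IsDistance G x y j) → k ℕ.≤ M
      k≤M (j , j≤M , w , _) = ℕ.≤-trans (proj₂ d j w) j≤M

    rounded-isIntegral : IsIntegralUltrametric rounded
    rounded-isIntegral = record
      { zero-self = λ x → zero-self x (rounded x x) (rounded≤u x x)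
      ; positive  = positive
      ; symmetric = λ x y → ℕ.≤-antisym (half x y) (half y x)
      ; strong    = strong
      }
      where
      zero-self : ∀ x k → fromℕ k ≤ u x x → k ≡ 0
      zero-self x zero    _   = refl
      zero-self x (suc k) k≤u = ⊥-elim (≤-trans {fromℕ (suc k)} {u x x} {0ℝ} k≤u
        (≃⇒≤ {u x x} {0ℝ} (≈⇒0 refl)) (0<fromℕ-suc k))
      positive : ∀ x y → x ≢ y → 1 ℕ.≤ rounded x y
      positive x y x≢y = from-distance (distance x y)
        where
        from-distance : (∃ λ k → k ℕ.≤ M × IsDistance G x y k) → 1 ℕ.≤ rounded x y
        from-distance (zero  , _ , [] , _) = ⊥-elim (x≢y refl)
        from-distance (suc k , _ , d)      = ℕ.≤-trans (s≤s z≤n) (distance≤rounded x y (suc k) d)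
      half : ∀ x y → rounded x y ℕ.≤ rounded y x
      half x y = rounded-largest y x (rounded x y) (rounded≤M x y)
        (≤-trans {fromℕ (rounded x y)} {u x y} {u y x} (rounded≤u x y)
          (≃⇒≤ {u x y} {u y x} (u-sym x y)))
      strong : ∀ x y z → rounded x z ℕ.≤ rounded x y ℕ.⊔ rounded y z
      strong x y z = from-either (≤-⊔ (fromℕ r) (u x y) (u y z)
        (≤-trans {fromℕ r} {u x z} {u x y ⊔ u y z} (rounded≤u x z) (triangle x y z)))
        where
        r = rounded x z
        from-either : fromℕ r ≤ u x y ⊎ fromℕ r ≤ u y z → r ℕ.≤ rounded x y ℕ.⊔ rounded y z
        from-either (inj₁ h) = ℕ.≤-trans (rounded-largest x y r (rounded≤M x z) h) (ℕ.m≤m⊔n _ _)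
        from-either (inj₂ h) = ℕ.≤-trans (rounded-largest y z r (rounded≤M x z) h)
          (ℕ.m≤n⊔m (rounded x y) _)

OPT-free-exists : ExcludedMiddle 0ℓ → ∀ (G : WeightedGraph n) → Connected G → ∃ (IsOPT-free G)
OPT-free-exists {n} em G connected =
  minimum-exists em G M (λ U → edgeSum G (DominatingUltrametric.u U)) start λ U →
      rounded G M distance U
    , rounded≤M G M distance U
    , (integral-dominating G (rounded G M distance U)
         (rounded-isIntegral G M distance U) (distance≤rounded G M distance U)
      , ≃-refl {edgeSum G λ x y → fromℕ (rounded G M distance U x y)})
    , EdgeSums.edgeSum-mono G _ (DominatingUltrametric.u U) (λ x y _ → rounded≤u G M distance U x y)
  where
  open Rounding em

  -- Walks exist between all pairs of vertices, so their lengths bound all graph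
  -- distances.
  walk-bound : ∃ λ M → ∀ x y → proj₁ (connected x y) ℕ.≤ M
  walk-bound = proj₁ total , λ x y → ℕ.≤-trans (proj₂ (row x) y) (proj₂ total x)
    where
    row : ∀ x → ∃ λ M → ∀ y → proj₁ (connected x y) ℕ.≤ M
    row x = upper-bound (λ y → proj₁ (connected x y))
    total = upper-bound (λ x → proj₁ (row x))

  M : ℕ
  M = proj₁ walk-bound

  distance≤M : ∀ x y k → IsDistance G x y k → k ℕ.≤ M
  distance≤M x y k d = ℕ.≤-trans (proj₂ d _ (proj₂ (connected x y))) (proj₂ walk-bound x y)

  distance : ∀ x y → ∃ λ k → k ℕ.≤ M × IsDistance G x y k
  distance x y with least em (Walk G x y) _ _ ℕ.≤-refl (proj₂ (connected x y))
  ... | k , d = k , distance≤M x y k d , d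

  start : DominatingUltrametric G
  start = uniform-dominating G (suc M) (s≤s z≤n) λ x y k d → ℕ.m≤n⇒m≤1+n (distance≤M x y k d)

corollary8 : ∀ (n : ℕ) → 2 ℕ.≤ n →
    (∀ (G : WeightedGraph n) → Connected G →
    (∀ (D F : ℝ) → IsOPT-D G D → IsOPT-free G F →
    Σ (0ℝ < F) λ 0<F → D ÷ F [ 0<F ] ≤ factor n)
    × (ExcludedMiddle 0ℓ → ∃ (IsOPT-D G) × ∃ (IsOPT-free G)))
    × (∀ (c : ℝ) →
    (∀ (G : WeightedGraph n) → Connected G →
    ∀ (D F : ℝ) → IsOPT-D G D → IsOPT-free G F →
    ∀ (0<F : 0ℝ < F) → D ÷ F [ 0<F ] ≤ c) →
    factor n ≤ c)
    × (∃ λ (D : ℝ) → ∃ λ (F : ℝ) → IsOPT-D (K n) D × IsOPT-free (K n) F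
    × Σ (0ℝ < F) λ 0<F → D ÷ F [ 0<F ] ≃ factor n)
corollary8 n 2≤n = upper , best-possible , attained
  where
  attained = K-ratio 2≤n

  upper : ∀ (G : WeightedGraph n) → Connected G →
    (∀ (D F : ℝ) → IsOPT-D G D → IsOPT-free G F →
      Σ (0ℝ < F) λ 0<F → D ÷ F [ 0<F ] ≤ factor n)
    × (ExcludedMiddle 0ℓ → ∃ (IsOPT-D G) × ∃ (IsOPT-free G))
  upper G connected = EdgeSums.ratio≤factor G 2≤n connected
    , λ em → OPT-D-exists em G (ℕ.≤-trans (s≤s z≤n) 2≤n) , OPT-free-exists em G connected

  best-possible : ∀ c →
    (∀ (G : WeightedGraph n) → Connected G → ∀ D F → IsOPT-D G D → IsOPT-free G F →
      ∀ (0<F : 0ℝ < F) → D ÷ F [ 0<F ] ≤ c) →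
    factor n ≤ c
  best-possible c bounded = compare attained
    where
    compare : (∃ λ D → ∃ λ F → IsOPT-D (K n) D × IsOPT-free (K n) F
      × Σ (0ℝ < F) λ 0<F → D ÷ F [ 0<F ] ≃ factor n) → factor n ≤ c
    compare (D , F , isD , isF , 0<F , ratio≃) = ≤-trans {factor n} {D ÷ F [ 0<F ]} {c}
      (≃⇒≤ {factor n} {D ÷ F [ 0<F ]} (≃-sym (D ÷ F [ 0<F ]) (factor n) ratio≃))
      (bounded (K n) (K-connected 2≤n) D F isD isF 0<F)
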